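{- For $q$ a prime power and $p$ a prime, consider the ratio $|T_q^p|/q^{q^p}$. Then: (i) for every fixed prime power $q$, $\displaystyle\lim_{p\to\infty}\frac{|T_q^p|}{q^{q^p}}=1$, where $p$ runs over the primes; (ii) for every fixed prime $p$, $\displaystyle\lim_{q\to\infty}\frac{|T_q^p|}{q^{q^p}}=0$, where $q$ runs over the prime powers.
   Context: For a prime power $q$ and a natural number $m\ge1$, a map $f:\mathbb{F}_{q^m}\to\mathbb{F}_{q^m}$ is called subfield preserving if $f(\mathbb{F}_q)\subseteq\mathbb{F}_q$ and, for all positive divisors $d,s$ of $m$, $f(\mathbb{F}_{q^d}\setminus\mathbb{F}_{q^s})\subseteq\mathbb{F}_{q^d}\setminus\mathbb{F}_{q^s}$. $T_q^m$ denotes the set of subfield preserving maps $f:\mathbb{F}_{q^m}\to\mathbb{F}_{q^m}$ whose polynomial representation (the unique polynomial of degree less than $q^m$ inducing $f$) has coefficients in $\mathbb{F}_q$. Here $m=p$. Note that $q^{q^p}=|\mathbb{F}_q[x]/(x^{q^p}-x)|$. -}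

module Defs where

open import Algebra.Apartness.Bundles using (HeytingCommutativeRing; HeytingField)
open import Algebra.Bundles using (CommutativeRing; Semiring)
import Algebra.Definitions.RawMonoid as RawMonoidDefs
import Algebra.Definitions.RawSemiring as RawSemiringDefs
open import Data.Fin.Base using (Fin; toℕ)
open import Data.Integer.Base using (+_)
open import Data.Nat.Base using (ℕ; suc; _^_; _<_; NonZero)
open import Data.Nat.Divisibility using (_∣_)
open import Data.Nat.Primality using (Prime; prime⇒nonZero)
open import Data.Nat.Properties using (m^n≢0)
open import Data.Product.Base using (Σ; ∃; ∃₂; _×_; _,_; proj₁)
open import Data.Rational.Base using (ℚ; _/_)
open import Data.Vec.Functional using (Vector)
open import Function.Bundles using (Func; Inverse; _⟨$⟩_)
import Function.Relation.Binary.Setoid.Equality as FuncEquality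
open import Level using (Level; _⊔_) renaming (suc to lsuc)
open import Relation.Binary.Bundles using (Setoid)
import Relation.Binary.Construct.On as On
open import Relation.Binary.Definitions using (_Respects_)
open import Relation.Binary.PropositionalEquality.Core using (_≡_; refl)
open import Relation.Binary.PropositionalEquality.Properties using (setoid)
open import Relation.Unary using (Pred; _∖_)

HasSize : ∀ {a ℓ} → Setoid a ℓ → ℕ → Set (a ⊔ ℓ)
HasSize S n = Inverse S (setoid (Fin n))

IsPrimePower : ℕ → Set
IsPrimePower q = ∃₂ λ r k → Prime r × q ≡ r ^ suc k

-- In a Heyting field of finite size both _≈_ and invertibility are decidable,
-- so _#_ is the negation of _≈_ and this is exactly a finite field.
record FiniteField (c ℓ₁ ℓ₂ : Level) (n : ℕ) : Set (lsuc (c ⊔ ℓ₁ ⊔ ℓ₂)) where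
  field
    heytingField : HeytingField c ℓ₁ ℓ₂

  commutativeRing : CommutativeRing c ℓ₁
  commutativeRing = HeytingCommutativeRing.commutativeRing
    (HeytingField.heytingCommutativeRing heytingField)

  field
    size : HasSize (CommutativeRing.setoid commutativeRing) n

module _ {c ℓ₁ ℓ₂ : Level} (q m : ℕ) (K : FiniteField c ℓ₁ ℓ₂ (q ^ m)) where

  open CommutativeRing (FiniteField.commutativeRing K)
    renaming (setoid to K-setoid) hiding (refl)
  open RawMonoidDefs +-rawMonoid using (sum)
  open RawSemiringDefs (Semiring.rawSemiring semiring) using () renaming (_^_ to _^ᴷ_)

  record IsSubfield (S : Pred Carrier ℓ₁) : Set (c ⊔ ℓ₁) where
    field
      resp       : S Respects _≈_
      0-closed   : S 0#
      1-closed   : S 1#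
      +-closed   : ∀ {x y} → S x → S y → S (x + y)
      *-closed   : ∀ {x y} → S x → S y → S (x * y)
      neg-closed : ∀ {x} → S x → S (- x)
      inv-closed : ∀ {x y} → S x → x * y ≈ 1# → S y

  subset : ∀ {ℓ} → Pred Carrier ℓ → Setoid (c ⊔ ℓ) ℓ₁
  subset S = On.setoid {B = Σ Carrier S} K-setoid proj₁

  -- 𝔽 n is the subfield of K with n elements; finite fields have at most one
  -- subfield of each order, so belonging to some such subfield is belonging to
  -- that one.
  𝔽 : ℕ → Pred Carrier (c ⊔ lsuc ℓ₁)
  𝔽 n x = ∃ λ (S : Pred Carrier ℓ₁) → IsSubfield S × HasSize (subset S) n × S x

  SubfieldPreserving : Pred (Func K-setoid K-setoid) (c ⊔ lsuc ℓ₁)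
  SubfieldPreserving f =
    (∀ x → 𝔽 q x → 𝔽 q (f ⟨$⟩ x)) ×
    (∀ d s → 0 < d → 0 < s → d ∣ m → s ∣ m →
      ∀ x → (𝔽 (q ^ d) ∖ 𝔽 (q ^ s)) x → (𝔽 (q ^ d) ∖ 𝔽 (q ^ s)) (f ⟨$⟩ x))

  -- A polynomial of degree less than n is its vector of n coefficients,
  -- constant term first.
  eval : ∀ {n} → Vector Carrier n → Carrier → Carrier
  eval a x = sum λ i → a i * x ^ᴷ toℕ i

  InT : Pred (Func K-setoid K-setoid) (c ⊔ lsuc ℓ₁)
  InT f = SubfieldPreserving f ×
    ∃ λ (a : Vector Carrier (q ^ m)) →
      (∀ x → f ⟨$⟩ x ≈ eval a x) × (∀ i → 𝔽 q (a i))

  -- Maps are identified when they agree pointwise.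
  T : Setoid (c ⊔ lsuc ℓ₁) (c ⊔ ℓ₁)
  T = On.setoid {B = Σ (Func K-setoid K-setoid) InT}
        (FuncEquality.setoid K-setoid K-setoid) proj₁

primePower⇒nonZero : ∀ {q} → IsPrimePower q → NonZero q
primePower⇒nonZero (r , k , pr , refl) = m^n≢0 r (suc k) {{prime⇒nonZero pr}}

ratio : ∀ {q} → IsPrimePower q → (p t : ℕ) → ℚ
ratio {q} qpp p t = _/_ (+ t) (q ^ (q ^ p))
  {{m^n≢0 q (q ^ p) {{primePower⇒nonZero qpp}}}}

{-# OPTIONS --safe #-}

-- The polynomial of a self-map f of K = F_{q^p} has coefficients in F_q exactly when f commutes
-- with the Frobenius map φ : x ↦ x^q, and F_q is the set of fixed points of φ.  Since p is prime,
-- φ has k = (q^p − q)/p further orbits, all of size p, so an f in T_q^p amounts to an arbitrary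
-- self-map of the q fixed points and an arbitrary moved image for one point of each other orbit:
-- |T_q^p| = q^q (q^p − q)^k, and the ratio is (1 − q/q^p)^k.  By Bernoulli's inequality it is at
-- least 1 − kq/q^p ≥ 1 − q/p, which tends to 1 with p, and at most 1/(1 + kq/q^p), which tends
-- to 0 as q grows, because kq/q^p ≥ q/2p.
module Submission where

open import Defs hiding (eval)
open import Algebra.Apartness.Bundles using (HeytingField)
open import Algebra.Bundles using (CommutativeRing)
import Algebra.Definitions.RawMonoid as RawMonoidDefs
import Algebra.Properties.CommutativeMonoid.Sum as Sum
import Algebra.Properties.CommutativeSemiring.Binomial as Binomial
import Algebra.Properties.CommutativeSemiring.Exp as CommutativeExp
import Algebra.Properties.Group as GroupProperties
import Algebra.Properties.Semiring.Exp as Exp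
import Algebra.Properties.Semiring.Mult as Mult
import Algebra.Properties.Semiring.Sum as SemiringSum
import Algebra.Solver.Ring.NaturalCoefficients.Default as SemiringSolver
open import Data.Empty using (⊥-elim)
open import Data.Fin.Base as Fin using (Fin; zero; suc; toℕ; fromℕ; fromℕ<; inject≤; punchIn; combine; remQuot; funToFin; finToFun)
import Data.Fin.Permutation as Perm
import Data.Fin.Properties as Fin
open import Data.Nat.Base as ℕ using (ℕ; zero; suc; _≤_; _<_; _∸_; _!; s≤s; z≤n; NonZero)
open import Data.Nat.Combinatorics using (_C_; nCk≡n!/k![n-k]!; k![n∸k]!∣n!; nCn≡1)
open import Data.Nat.Divisibility using (_∣_; divides; m∣m*n; ∣⇒≤)
open import Data.Nat.DivMod using (m/n*n≡m)
open import Data.Nat.GeneralisedArithmetic using (fold; fold-+)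
open import Data.Nat.Primality using (Prime; prime⇒nonZero; prime⇒nonTrivial; euclidsLemma; prime⇒irreducible)
import Data.Nat.Properties as ℕ
open import Data.Nat.Tactic.RingSolver using (solve-∀)
open import Data.Product.Base using (Σ; ∃; ∃₂; _×_; _,_; proj₁; proj₂; uncurry)
import Data.Rational.Base as ℚ
open import Data.Sum.Base using (_⊎_; inj₁; inj₂; [_,_]′)
open import Data.Unit.Base using (⊤)
open import Data.Vec.Functional using (Vector; _∷_; []; head; tail; init; last; removeAt)
open import Function.Base using (_∘_)
open import Function.Bundles using (Inverse; Func; _⟨$⟩_; mk↔ₛ′)
import Function.Construct.Composition as Compose
open import Function.Definitions using (Injective)
open import Level using (Level; Lift)
import Relation.Binary.Construct.On as On
import Relation.Binary.Definitions as Binary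
open import Relation.Binary.PropositionalEquality.Core as ≡ using (_≡_; _≢_)
import Relation.Binary.Reasoning.Setoid as SetoidReasoning
open import Relation.Nullary using (¬_; yes; no; contradiction; ¬?)
open import Relation.Nullary.Decidable using (map′; _×-dec_)
open import Relation.Unary using (Pred; Decidable)

module Estimates where

  open import Data.Integer.Base as ℤ using (+_; +[1+_]; -[1+_]; +<+)
  import Data.Integer.Properties as ℤ
  open import Data.Nat.Base
  open import Data.Nat.Properties
  open import Data.Rational.Base as ℚ using (ℚ; mkℚ; 0ℚ; 1ℚ; toℚᵘ)
  import Data.Rational.Properties as ℚ
  open import Data.Rational.Unnormalised.Base as ℚᵘ using (mkℚᵘ)
  import Data.Rational.Unnormalised.Properties as ℚᵘ
  open import Relation.Binary.PropositionalEquality using (_≡_; refl; sym; trans; cong; cong₂; subst; subst₂; module ≡-Reasoning)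

  toℚᵘ-/ : ∀ t D .{{_ : NonZero D}} → toℚᵘ (+ t ℚ./ D) ℚᵘ.≃ (+ t ℚᵘ./ D)
  toℚᵘ-/ t (suc D) = ℚ.toℚᵘ-fromℚᵘ (mkℚᵘ (+ t) D)

  ∣t/D-r∣<ε : ∀ t D .{{_ : NonZero D}} r ε →
    ℚᵘ.∣ (+ t ℚᵘ./ D) ℚᵘ.- toℚᵘ r ∣ ℚᵘ.< toℚᵘ ε → ℚ.∣ (+ t ℚ./ D) ℚ.- r ∣ ℚ.< ε
  ∣t/D-r∣<ε t D r ε <ε = ℚ.toℚᵘ-cancel-< (ℚᵘ.<-respˡ-≃ (ℚᵘ.≃-sym eq) <ε)
    where
    x = + t ℚ./ D
    eq : toℚᵘ ℚ.∣ x ℚ.- r ∣ ℚᵘ.≃ ℚᵘ.∣ (+ t ℚᵘ./ D) ℚᵘ.- toℚᵘ r ∣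
    eq = ℚᵘ.≃-trans (ℚ.toℚᵘ-homo-∣-∣ (x ℚ.- r)) (ℚᵘ.∣-∣-cong (ℚᵘ.≃-trans (ℚ.toℚᵘ-homo-+ x (ℚ.- r))
      (ℚᵘ.+-cong (toℚᵘ-/ t D) (ℚ.toℚᵘ-homo‿- r))))

  near-0 : ∀ t D .{{_ : NonZero D}} (ε : ℚ) → 0ℚ ℚ.< ε → t * ℚ.↧ₙ ε < D →
           ℚ.∣ (+ t ℚ./ D) ℚ.- 0ℚ ∣ ℚ.< ε
  near-0 t (suc D) ε@(mkℚ +[1+ n ] d _) _ t*d<D = ∣t/D-r∣<ε t (suc D) 0ℚ ε
    (ℚᵘ.*<* (subst₂ ℤ._<_ (ℤ.pos-* ∣t∣ (suc d)) (ℤ.pos-* (suc n) (suc D * 1)) (+<+ lt)))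
    where
    ∣t∣ = ℤ.∣ + t ℤ.* + 1 ℤ.+ + 0 ℤ.* + suc D ∣
    ∣t∣≡t : ∣t∣ ≡ t
    ∣t∣≡t = cong ℤ.∣_∣ (trans (ℤ.+-identityʳ (+ t ℤ.* + 1)) (ℤ.*-identityʳ (+ t)))
    lt : ∣t∣ * suc d < suc n * (suc D * 1)
    lt = begin-strict
      ∣t∣ * suc d           ≡⟨ cong (_* suc d) ∣t∣≡t ⟩
      t * suc d             <⟨ t*d<D ⟩
      suc D                 ≡⟨ *-identityʳ (suc D) ⟨
      suc D * 1             ≤⟨ m≤n*m (suc D * 1) (suc n) ⟩
      suc n * (suc D * 1)   ∎ where open ≤-Reasoning
  near-0 _ _ (mkℚ (+ 0) _ _) (ℚ.*<* (+<+ ())) _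
  near-0 _ _ (mkℚ -[1+ _ ] _ _) (ℚ.*<* ()) _

  near-1 : ∀ t D .{{_ : NonZero D}} (ε : ℚ) → 0ℚ ℚ.< ε → t ≤ D → D * ℚ.↧ₙ ε < t * ℚ.↧ₙ ε + D →
           ℚ.∣ (+ t ℚ./ D) ℚ.- 1ℚ ∣ ℚ.< ε
  near-1 t (suc D) ε@(mkℚ +[1+ n ] d _) _ t≤D D*d<t*d+D = ∣t/D-r∣<ε t (suc D) 1ℚ ε
    (ℚᵘ.*<* (subst₂ ℤ._<_ (ℤ.pos-* ∣t∣ (suc d)) (ℤ.pos-* (suc n) (suc D * 1)) (+<+ lt)))
    where
    ∣t∣ = ℤ.∣ + t ℤ.* + 1 ℤ.+ -[1+ 0 ] ℤ.* + suc D ∣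
    ∣t∣≡D∸t : ∣t∣ ≡ suc D ∸ t
    ∣t∣≡D∸t = trans (cong ℤ.∣_∣ (trans (cong₂ ℤ._+_ (ℤ.*-identityʳ (+ t)) (ℤ.-1*i≡-i (+ suc D))) (ℤ.m-n≡m⊖n t (suc D))))
      (ℤ.∣⊖∣-≤ t≤D)
    lt : ∣t∣ * suc d < suc n * (suc D * 1)
    lt = begin-strict
      ∣t∣ * suc d                  ≡⟨ cong (_* suc d) ∣t∣≡D∸t ⟩
      (suc D ∸ t) * suc d          ≡⟨ *-distribʳ-∸ (suc d) (suc D) t ⟩
      suc D * suc d ∸ t * suc d    <⟨ m<n+o⇒m∸n<o (suc D * suc d) (t * suc d) D*d<t*d+D ⟩
      suc D                        ≡⟨ *-identityʳ (suc D) ⟨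
      suc D * 1                    ≤⟨ m≤n*m (suc D * 1) (suc n) ⟩
      suc n * (suc D * 1)          ∎ where open ≤-Reasoning
  near-1 _ _ (mkℚ (+ 0) _ _) (ℚ.*<* (+<+ ())) _ _
  near-1 _ _ (mkℚ -[1+ _ ] _ _) (ℚ.*<* ()) _ _

  -- Bernoulli's inequality 1 ≤ (1 − q/Q)ᵏ + k q/Q with a = Q − q, cleared of denominators.
  bernoulli-lower : ∀ q a k → let Q = q + a in Q * Q ^ k ≤ Q * a ^ k + k * q * Q ^ k
  bernoulli-lower q a zero = m≤m+n _ _
  bernoulli-lower q a (suc k) = begin
    Q * (Q * Q ^ k)                                ≤⟨ *-monoʳ-≤ Q (bernoulli-lower q a k) ⟩
    Q * (Q * a ^ k + k * q * Q ^ k)                ≡⟨ expand q a (a ^ k) (k * q * Q ^ k) ⟩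
    Q * (a * a ^ k) + q * (Q * a ^ k) + Q * (k * q * Q ^ k)
      ≤⟨ +-monoˡ-≤ _ (+-monoʳ-≤ (Q * (a * a ^ k)) (*-monoʳ-≤ q (*-monoʳ-≤ Q (^-monoˡ-≤ k (m≤n+m a q))))) ⟩
    Q * (a * a ^ k) + q * (Q * Q ^ k) + Q * (k * q * Q ^ k)  ≡⟨ collect q Q (a * a ^ k) (Q ^ k) k ⟩
    Q * (a * a ^ k) + suc k * q * (Q * Q ^ k)      ∎
    where
    open ≤-Reasoning
    Q = q + a
    expand : ∀ q a b c → (q + a) * ((q + a) * b + c) ≡ (q + a) * (a * b) + q * ((q + a) * b) + (q + a) * c
    expand = solve-∀
    collect : ∀ q Q b c k → Q * b + q * (Q * c) + Q * (k * q * c) ≡ Q * b + suc k * q * (Q * c)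
    collect = solve-∀

  -- The matching upper bound (1 − q/Q)ᵏ (1 + k q/Q) ≤ 1.
  bernoulli-upper : ∀ q a k → let Q = q + a in a ^ k * (Q + k * q) ≤ Q ^ k * Q
  bernoulli-upper q a zero = ≤-reflexive (base q a)
    where
    base : ∀ q a → 1 * (q + a + 0) ≡ 1 * (q + a)
    base = solve-∀
  bernoulli-upper q a (suc k) = begin
    a * a ^ k * (Q + suc k * q)                            ≤⟨ m≤m+n _ (a ^ k * (q * (q + k * q))) ⟩
    a * a ^ k * (Q + suc k * q) + a ^ k * (q * (q + k * q)) ≡⟨ factor q a (a ^ k) k ⟩
    Q * (a ^ k * (Q + k * q))                              ≤⟨ *-monoʳ-≤ Q (bernoulli-upper q a k) ⟩
    Q * (Q ^ k * Q)                                        ≡⟨ *-assoc Q (Q ^ k) Q ⟨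
    Q * Q ^ k * Q                                          ∎
    where
    open ≤-Reasoning
    Q = q + a
    factor : ∀ q a b k → a * b * (q + a + suc k * q) + b * (q * (q + k * q)) ≡ (q + a) * (b * (q + a + k * q))
    factor = solve-∀

  ^-orbits : ∀ q p k → q + k * p ≡ q ^ p → q ^ (q ^ p) ≡ q ^ q * (q ^ p) ^ k
  ^-orbits q p k eq = begin
    q ^ (q ^ p)            ≡⟨ cong (q ^_) eq ⟨
    q ^ (q + k * p)        ≡⟨ ^-distribˡ-+-* q q (k * p) ⟩
    q ^ q * q ^ (k * p)    ≡⟨ cong (λ e → q ^ q * q ^ e) (*-comm k p) ⟩
    q ^ q * q ^ (p * k)    ≡⟨ cong (q ^ q *_) (^-*-assoc q p k) ⟨
    q ^ q * (q ^ p) ^ k    ∎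
    where open ≡-Reasoning

  module _ (q p k : ℕ) .{{_ : NonZero q}} (q+kp≡Q : q + k * p ≡ q ^ p) (d : ℕ) where

    private
      Q = q ^ p
      a = k * p
      t = q ^ q * a ^ k
      D = q ^ Q
      D≡ : q ^ q * Q ^ k ≡ D
      D≡ = sym (^-orbits q p k q+kp≡Q)
      instance
        Q≢0 : NonZero Q
        Q≢0 = m^n≢0 q p
        q^q≢0 : NonZero (q ^ q)
        q^q≢0 = m^n≢0 q q

    open ≤-Reasoning

    count≤ : t ≤ D
    count≤ = begin
      q ^ q * a ^ k  ≤⟨ *-monoʳ-≤ (q ^ q) (^-monoˡ-≤ k (≤-trans (m≤n+m a q) (≤-reflexive q+kp≡Q))) ⟩
      q ^ q * Q ^ k  ≡⟨ D≡ ⟩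
      D              ∎

    count-lower : suc (q * d) ≤ p → D * d < t * d + D
    count-lower qd<p = subst (λ D → D * d < t * d + D) D≡ (*-cancelʳ-< p _ _ (begin-strict
      q ^ q * Q ^ k * d * p                          ≡⟨ move₁ (q ^ q) (Q ^ k) d p ⟩
      q ^ q * d * (p * Q ^ k)                        ≤⟨ *-monoʳ-≤ (q ^ q * d) scaled ⟩
      q ^ q * d * (p * a ^ k + q * Q ^ k)            ≡⟨ move₂ (q ^ q) d p (a ^ k) q (Q ^ k) ⟩
      t * d * p + q ^ q * Q ^ k * (q * d)            <⟨ +-monoʳ-< (t * d * p) (*-monoʳ-< (q ^ q * Q ^ k) qd<p) ⟩
      t * d * p + q ^ q * Q ^ k * p                  ≡⟨ *-distribʳ-+ p (t * d) (q ^ q * Q ^ k) ⟨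
      (t * d + q ^ q * Q ^ k) * p                    ∎))
      where
      instance
        _ = m^n≢0 Q k
        _ = m*n≢0 (q ^ q) (Q ^ k)
      move₁ : ∀ b c d p → b * c * d * p ≡ b * d * (p * c)
      move₁ = solve-∀
      move₂ : ∀ b d p e q c → b * d * (p * e + q * c) ≡ b * e * d * p + b * c * (q * d)
      move₂ = solve-∀
      scaled : p * Q ^ k ≤ p * a ^ k + q * Q ^ k
      scaled = *-cancelˡ-≤ Q (begin
        Q * (p * Q ^ k)                        ≡⟨ m₁ Q p (Q ^ k) ⟩
        p * (Q * Q ^ k)                        ≤⟨ *-monoʳ-≤ p (subst (λ Q → Q * Q ^ k ≤ Q * a ^ k + k * q * Q ^ k) q+kp≡Q (bernoulli-lower q a k)) ⟩
        p * (Q * a ^ k + k * q * Q ^ k)        ≡⟨ m₂ Q p (a ^ k) k q (Q ^ k) ⟩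
        Q * (p * a ^ k) + k * p * (q * Q ^ k)  ≤⟨ +-monoʳ-≤ (Q * (p * a ^ k)) (*-monoˡ-≤ (q * Q ^ k) (≤-trans (m≤n+m a q) (≤-reflexive q+kp≡Q))) ⟩
        Q * (p * a ^ k) + Q * (q * Q ^ k)      ≡⟨ *-distribˡ-+ Q (p * a ^ k) (q * Q ^ k) ⟨
        Q * (p * a ^ k + q * Q ^ k)            ∎)
        where
        m₁ : ∀ Q p c → Q * (p * c) ≡ p * (Q * c)
        m₁ = solve-∀
        m₂ : ∀ Q p e k q c → p * (Q * e + k * q * c) ≡ Q * (p * e) + k * p * (q * c)
        m₂ = solve-∀

    count-upper : 2 ≤ q → 2 ≤ p → 2 * p * d ≤ q → t * d < D
    count-upper 2≤q 2≤p 2pd≤q = subst (t * d <_) D≡ (begin-strict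
      q ^ q * a ^ k * d      ≡⟨ *-assoc (q ^ q) (a ^ k) d ⟩
      q ^ q * (a ^ k * d)    <⟨ *-monoʳ-< (q ^ q) (*-cancelʳ-< Q _ _ bound) ⟩
      q ^ q * Q ^ k          ∎)
      where
      2q≤Q : 2 * q ≤ Q
      2q≤Q = begin
        2 * q  ≤⟨ *-monoˡ-≤ q 2≤q ⟩
        q * q  ≡⟨ cong (q *_) (*-identityʳ q) ⟨
        q ^ 2  ≤⟨ ^-monoʳ-≤ q 2≤p ⟩
        q ^ p  ∎
      q≤a : q ≤ a
      q≤a = +-cancelˡ-≤ q q a (begin
        q + q  ≡⟨ cong (λ z → q + z) (+-identityʳ q) ⟨
        2 * q  ≤⟨ 2q≤Q ⟩
        Q      ≡⟨ q+kp≡Q ⟨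
        q + a  ∎)
      instance
        a≢0 : NonZero a
        a≢0 = >-nonZero (≤-trans (>-nonZero⁻¹ q) q≤a)
        _ = m^n≢0 a k
        _ = m*n≢0 (a ^ k) Q
        p≢0 : NonZero p
        p≢0 = >-nonZero (≤-trans (s≤s z≤n) 2≤p)
      Qd≤kq : Q * d ≤ k * q
      Qd≤kq = *-cancelʳ-≤ (Q * d) (k * q) (2 * p) {{m*n≢0 2 p}} (begin
        Q * d * (2 * p)       ≡⟨ m₁ Q d p ⟩
        Q * (2 * p * d)       ≤⟨ *-monoʳ-≤ Q 2pd≤q ⟩
        Q * q                 ≡⟨ cong (_* q) q+kp≡Q ⟨
        (q + k * p) * q       ≤⟨ *-monoˡ-≤ q (+-monoˡ-≤ a q≤a) ⟩
        (k * p + k * p) * q   ≡⟨ m₂ k p q ⟩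
        k * q * (2 * p)       ∎)
        where
        m₁ : ∀ Q d p → Q * d * (2 * p) ≡ Q * (2 * p * d)
        m₁ = solve-∀
        m₂ : ∀ k p q → (k * p + k * p) * q ≡ k * q * (2 * p)
        m₂ = solve-∀
      bound : a ^ k * d * Q < Q ^ k * Q
      bound = begin-strict
        a ^ k * d * Q                   ≡⟨ trans (*-assoc (a ^ k) d Q) (cong (a ^ k *_) (*-comm d Q)) ⟩
        a ^ k * (Q * d)                 ≤⟨ *-monoʳ-≤ (a ^ k) Qd≤kq ⟩
        a ^ k * (k * q)                 <⟨ *-monoʳ-< (a ^ k) (m<n+m (k * q) (>-nonZero⁻¹ Q)) ⟩
        a ^ k * (Q + k * q)             ≤⟨ subst (λ Q → a ^ k * (Q + k * q) ≤ Q ^ k * Q) q+kp≡Q (bernoulli-upper q a k) ⟩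
        Q ^ k * Q                       ∎

module Orbits where

  open import Data.Nat.Base
  open import Data.Nat.Coprimality using (prime⇒coprime; coprime-Bézout)
  open import Data.Nat.DivMod using (_%_; _/_; m≡m%n+[m/n]*n; m%n<n; m<n⇒m%n≡m)
  open import Data.Nat.GCD using (module Bézout)
  open import Data.Nat.Properties
  open import Relation.Binary.PropositionalEquality using (_≡_; _≢_; _≗_; refl; sym; trans; cong; cong₂; subst; module ≡-Reasoning; _→-setoid_)

  record Enumeration {n ℓ} (P : Pred (Fin n) ℓ) : Set ℓ where
    field
      size : ℕ
      enum : Fin size → Fin n
      enum-injective : Injective _≡_ _≡_ enum
      enum-∈ : ∀ i → P (enum i)
      index : ∀ {x} → P x → ∃ λ i → enum i ≡ x

  enumerate : ∀ {n ℓ} {P : Pred (Fin n) ℓ} → Decidable P → Enumeration P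
  enumerate {zero} P? = record
    { size = 0 ; enum = λ () ; enum-injective = λ { {()} } ; enum-∈ = λ () ; index = λ { {()} } }
  enumerate {suc n} P? with P? zero | enumerate (P? ∘ suc)
  ... | yes p₀ | e = record
    { size = suc size
    ; enum = λ { zero → zero ; (suc i) → suc (enum i) }
    ; enum-injective = λ { {zero} {zero} _ → refl ; {suc i} {suc j} eq → cong suc (enum-injective (Fin.suc-injective eq)) }
    ; enum-∈ = λ { zero → p₀ ; (suc i) → enum-∈ i }
    ; index = λ { {zero} _ → zero , refl ; {suc x} p → let i , eq = index p in suc i , cong suc eq }
    } where open Enumeration e
  ... | no ¬p₀ | e = record
    { size = size
    ; enum = suc ∘ enum
    ; enum-injective = enum-injective ∘ Fin.suc-injective
    ; enum-∈ = enum-∈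
    ; index = λ { {zero} p → contradiction p ¬p₀ ; {suc x} p → let i , eq = index p in i , cong suc eq }
    } where open Enumeration e

  record Transversal {n ℓ} (_∼_ : Fin n → Fin n → Set ℓ) : Set ℓ where
    field
      rep : Fin n → Fin n
      rep-∼ : ∀ x → rep x ∼ x
      rep-cong : ∀ {x y} → x ∼ y → rep x ≡ rep y

  transversal : ∀ {n ℓ} {_∼_ : Fin n → Fin n → Set ℓ} → (∀ x → x ∼ x) →
                (∀ {x y} → x ∼ y → y ∼ x) → (∀ {x y z} → x ∼ y → y ∼ z → x ∼ z) →
                (∀ x → Decidable (x ∼_)) → Transversal _∼_
  transversal {zero} rfl sm tr ∼? = record { rep = λ () ; rep-∼ = λ () ; rep-cong = λ { {()} } }
  transversal {suc n} {_∼_ = _∼_} rfl sm tr ∼? = record { rep = rep ; rep-∼ = rep-∼ ; rep-cong = rep-cong }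
    where
    module R = Transversal (transversal {_∼_ = λ x y → suc x ∼ suc y} (rfl ∘ suc) sm tr (λ x y → ∼? (suc x) (suc y)))
    rep : Fin (suc n) → Fin (suc n)
    rep zero = zero
    rep (suc x) with ∼? zero (suc x)
    ... | yes _ = zero
    ... | no _ = suc (R.rep x)
    rep-∼ : ∀ x → rep x ∼ x
    rep-∼ zero = rfl zero
    rep-∼ (suc x) with ∼? zero (suc x)
    ... | yes 0∼x = 0∼x
    ... | no _ = R.rep-∼ x
    rep-cong : ∀ {x y} → x ∼ y → rep x ≡ rep y
    rep-cong {zero} {zero} _ = refl
    rep-cong {zero} {suc y} 0∼y with ∼? zero (suc y)
    ... | yes _ = refl
    ... | no 0≁y = contradiction 0∼y 0≁y
    rep-cong {suc x} {zero} x∼0 with ∼? zero (suc x)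
    ... | yes _ = refl
    ... | no 0≁x = contradiction (sm x∼0) 0≁x
    rep-cong {suc x} {suc y} x∼y with ∼? zero (suc x) | ∼? zero (suc y)
    ... | yes _ | yes _ = refl
    ... | yes 0∼x | no 0≁y = contradiction (tr 0∼x x∼y) 0≁y
    ... | no 0≁x | yes 0∼y = contradiction (tr 0∼y (sm x∼y)) 0≁x
    ... | no _ | no _ = cong suc (R.rep-cong x∼y)

  funToFin-cong : ∀ {m n} {f g : Fin m → Fin n} → f ≗ g → funToFin f ≡ funToFin g
  funToFin-cong {zero} _ = refl
  funToFin-cong {suc m} f≗g = cong₂ combine (f≗g zero) (funToFin-cong (f≗g ∘ suc))

  remQuot-injective : ∀ {m} n {s t : Fin (m * n)} → remQuot {m} n s ≡ remQuot {m} n t → s ≡ t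
  remQuot-injective {m} n {s} {t} eq = trans (sym (Fin.combine-remQuot {m} n s))
    (trans (cong (uncurry combine) eq) (Fin.combine-remQuot {m} n t))

  module _ {n : ℕ} (φ : Fin n → Fin n) where

    record Admissible (g : Fin n → Fin n) : Set where
      field
        commutes : ∀ x → g (φ x) ≡ φ (g x)
        moves : ∀ x → φ x ≢ x → φ (g x) ≢ g x

    AdmissibleMaps = On.setoid {B = Σ (Fin n → Fin n) Admissible} (Fin n →-setoid Fin n) proj₁

    record OrbitDecomposition (p : ℕ) : Set where
      field
        #fixed #free : ℕ
        fix : Fin #fixed → Fin n
        fix-injective : Injective _≡_ _≡_ fix
        fix-fixed : ∀ i → φ (fix i) ≡ fix i
        fix-index : ∀ x → φ x ≡ x → ∃ λ i → fix i ≡ x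
        orb : Fin #free → Fin n
        orb-moved : ∀ b → φ (orb b) ≢ orb b
        orb-injective : ∀ {b b′} (j j′ : Fin p) → fold (orb b) φ (toℕ j) ≡ fold (orb b′) φ (toℕ j′) → b ≡ b′ × j ≡ j′
        orb-index : ∀ x → φ x ≢ x → ∃₂ λ b (j : Fin p) → fold (orb b) φ (toℕ j) ≡ x

    module PrimeOrder {p : ℕ} (p-prime : Prime p) (φᵖ≗id : ∀ x → fold x φ p ≡ x) where

      private instance
        p≢0 : NonZero p
        p≢0 = prime⇒nonZero p-prime

      fold-comm : ∀ x a b → fold (fold x φ a) φ b ≡ fold (fold x φ b) φ a
      fold-comm x a b = trans (sym (fold-+ x φ b)) (trans (cong (fold x φ) (+-comm b a)) (fold-+ x φ a))

      fold-stable : ∀ {x} d → fold x φ d ≡ x → ∀ m → fold x φ (m * d) ≡ x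
      fold-stable d eq zero = refl
      fold-stable {x} d eq (suc m) = begin
        fold x φ (d + m * d)         ≡⟨ fold-+ x φ d ⟩
        fold (fold x φ (m * d)) φ d  ≡⟨ cong (λ y → fold y φ d) (fold-stable d eq m) ⟩
        fold x φ d                   ≡⟨ eq ⟩
        x                            ∎
        where open ≡-Reasoning

      fold-% : ∀ x m → fold x φ (m % p) ≡ fold x φ m
      fold-% x m = begin
        fold x φ (m % p)                          ≡⟨ cong (λ y → fold y φ (m % p)) (fold-stable p (φᵖ≗id x) (m / p)) ⟨
        fold (fold x φ (m / p * p)) φ (m % p)     ≡⟨ fold-+ x φ (m % p) ⟨
        fold x φ (m % p + m / p * p)              ≡⟨ cong (fold x φ) (m≡m%n+[m/n]*n m p) ⟨
        fold x φ m                                ∎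
        where open ≡-Reasoning

      fold-cancel : ∀ j {x y} → fold x φ j ≡ fold y φ j → x ≡ y
      fold-cancel j {x} {y} eq = trans (sym (back x)) (trans (cong (λ z → fold z φ (j * pred p)) eq) (back y))
        where
        back : ∀ x → fold (fold x φ j) φ (j * pred p) ≡ x
        back x = begin
          fold (fold x φ j) φ (j * pred p)  ≡⟨ fold-comm x j (j * pred p) ⟩
          fold (fold x φ (j * pred p)) φ j  ≡⟨ fold-+ x φ j ⟨
          fold x φ (j + j * pred p)         ≡⟨ cong (fold x φ) (trans (sym (*-suc j (pred p))) (cong (j *_) (suc-pred p))) ⟩
          fold x φ (j * p)                  ≡⟨ fold-stable p (φᵖ≗id x) j ⟩
          x                                 ∎
          where open ≡-Reasoning

      φ-injective : Injective _≡_ _≡_ φ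
      φ-injective = fold-cancel 1

      fold-moved : ∀ j {x} → φ x ≢ x → φ (fold x φ j) ≢ fold x φ j
      fold-moved j {x} moved eq = moved (fold-cancel j (trans (fold-comm x 1 j) eq))

      fold-fixed : ∀ {x} → φ x ≡ x → ∀ j → fold x φ j ≡ x
      fold-fixed {x} eq j = trans (cong (fold x φ) (sym (*-identityʳ j))) (fold-stable 1 eq j)

      -- A period d < p is coprime to p, so by Bézout it would make 1 a period as well.
      period≡0 : ∀ {x} → φ x ≢ x → ∀ d → d < p → fold x φ d ≡ x → d ≡ 0
      period≡0 moved zero _ _ = refl
      period≡0 {x} moved d@(suc _) d<p eq with coprime-Bézout (prime⇒coprime p-prime d<p)
      ... | Bézout.+- u v 1+vd≡up = contradiction (trans (sym (cong φ (fold-stable d eq v)))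
              (trans (cong (fold x φ) 1+vd≡up) (fold-stable p (φᵖ≗id x) u))) moved
      ... | Bézout.-+ u v 1+up≡vd = contradiction (trans (sym (cong φ (fold-stable p (φᵖ≗id x) u)))
              (trans (cong (fold x φ) 1+up≡vd) (fold-stable d eq v))) moved

      private
        fold-agree-≤ : ∀ {r} → φ r ≢ r → ∀ {a b} → a ≤ b → fold r φ a ≡ fold r φ b → (b ∸ a) % p ≡ 0
        fold-agree-≤ {r} moved {a} {b} a≤b eq = period≡0 moved (d % p) (m%n<n d p)
          (trans (fold-% r d) (fold-cancel a (trans (trans (sym (fold-+ r φ a)) (cong (fold r φ) (m+[n∸m]≡n a≤b))) (sym eq))))
          where d = b ∸ a

        fold-agree′ : ∀ {r} → φ r ≢ r → ∀ {a b} → a ≤ b → fold r φ a ≡ fold r φ b → ∀ y → fold y φ a ≡ fold y φ b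
        fold-agree′ {r} moved {a} {b} a≤b eq y = begin
          fold y φ a                         ≡⟨ cong (λ z → fold z φ a) (trans (sym (fold-% y d)) (cong (fold y φ) (fold-agree-≤ moved a≤b eq))) ⟨
          fold (fold y φ d) φ a              ≡⟨ fold-+ y φ a ⟨
          fold y φ (a + d)                   ≡⟨ cong (fold y φ) (m+[n∸m]≡n a≤b) ⟩
          fold y φ b                         ∎
          where
          open ≡-Reasoning
          d = b ∸ a

      fold-agree : ∀ {r} → φ r ≢ r → ∀ {a b} → fold r φ a ≡ fold r φ b → ∀ y → fold y φ a ≡ fold y φ b
      fold-agree moved {a} {b} eq y with ≤-total a b
      ... | inj₁ a≤b = fold-agree′ moved a≤b eq y
      ... | inj₂ b≤a = sym (fold-agree′ moved b≤a (sym eq) y)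

      private
        exponent-≤ : ∀ {r} → φ r ≢ r → (i j : Fin p) → toℕ i ≤ toℕ j → fold r φ (toℕ i) ≡ fold r φ (toℕ j) → i ≡ j
        exponent-≤ moved i j i≤j eq = Fin.toℕ-injective (≤-antisym i≤j (m∸n≡0⇒m≤n
          (trans (sym (m<n⇒m%n≡m (≤-<-trans (m∸n≤m (toℕ j) (toℕ i)) (Fin.toℕ<n j)))) (fold-agree-≤ moved i≤j eq))))

      exponent-injective : ∀ {r} → φ r ≢ r → (i j : Fin p) → fold r φ (toℕ i) ≡ fold r φ (toℕ j) → i ≡ j
      exponent-injective moved i j eq with ≤-total (toℕ i) (toℕ j)
      ... | inj₁ i≤j = exponent-≤ moved i j i≤j eq
      ... | inj₂ j≤i = sym (exponent-≤ moved j i j≤i (sym eq))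

      _∼_ : Fin n → Fin n → Set
      x ∼ y = ∃ λ (j : Fin p) → fold x φ (toℕ j) ≡ y

      fold⇒∼ : ∀ {x y} m → fold x φ m ≡ y → x ∼ y
      fold⇒∼ {x} m eq = fromℕ< (m%n<n m p) ,
        trans (cong (fold x φ) (Fin.toℕ-fromℕ< (m%n<n m p))) (trans (fold-% x m) eq)

      ∼-sym : ∀ {x y} → x ∼ y → y ∼ x
      ∼-sym {x} {y} (j , eq) = fold⇒∼ (p ∸ toℕ j) (begin
        fold y φ (p ∸ toℕ j)                     ≡⟨ cong (λ z → fold z φ (p ∸ toℕ j)) eq ⟨
        fold (fold x φ (toℕ j)) φ (p ∸ toℕ j)    ≡⟨ fold-+ x φ (p ∸ toℕ j) ⟨
        fold x φ (p ∸ toℕ j + toℕ j)             ≡⟨ cong (fold x φ) (m∸n+n≡m (<⇒≤ (Fin.toℕ<n j))) ⟩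
        fold x φ p                               ≡⟨ φᵖ≗id x ⟩
        x                                        ∎)
        where open ≡-Reasoning

      ∼-trans : ∀ {x y z} → x ∼ y → y ∼ z → x ∼ z
      ∼-trans {x} (i , refl) (j , eq) = fold⇒∼ (toℕ j + toℕ i) (trans (fold-+ x φ (toℕ j)) eq)

      orbitDecomposition : OrbitDecomposition p
      orbitDecomposition = record
        { #fixed = F.size
        ; #free = R.size
        ; fix = F.enum
        ; fix-injective = F.enum-injective
        ; fix-fixed = F.enum-∈
        ; fix-index = λ _ → F.index
        ; orb = R.enum
        ; orb-moved = proj₁ ∘ R.enum-∈
        ; orb-injective = orb-injective
        ; orb-index = orb-index
        }
        where
        open Transversal (transversal {_∼_ = _∼_} (λ _ → fold⇒∼ 0 refl) ∼-sym ∼-trans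
          (λ x y → Fin.any? λ j → fold x φ (toℕ j) Fin.≟ y))
        module F = Enumeration (enumerate (λ x → φ x Fin.≟ x))
        module R = Enumeration (enumerate (λ x → ¬? (φ x Fin.≟ x) ×-dec (rep x Fin.≟ x)))
        same-rep : ∀ {b b′} (j j′ : Fin p) → fold (R.enum b) φ (toℕ j) ≡ fold (R.enum b′) φ (toℕ j′) → R.enum b ≡ R.enum b′
        same-rep {b} {b′} j j′ eq = trans (sym (proj₂ (R.enum-∈ b)))
          (trans (rep-cong (∼-trans (j , eq) (∼-sym (j′ , refl)))) (proj₂ (R.enum-∈ b′)))
        orb-injective : ∀ {b b′} (j j′ : Fin p) → fold (R.enum b) φ (toℕ j) ≡ fold (R.enum b′) φ (toℕ j′) → b ≡ b′ × j ≡ j′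
        orb-injective {b} j j′ eq with refl ← R.enum-injective (same-rep j j′ eq) =
          refl , exponent-injective (proj₁ (R.enum-∈ b)) j j′ eq
        orb-index : ∀ x → φ x ≢ x → ∃₂ λ b (j : Fin p) → fold (R.enum b) φ (toℕ j) ≡ x
        orb-index x moved = let j , eq = rep-∼ x
                                b , b≡ = R.index (rep-moved , rep-cong (rep-∼ x))
                            in b , j , trans (cong (λ y → fold y φ (toℕ j)) b≡) eq
          where
          rep-moved : φ (rep x) ≢ rep x
          rep-moved fixed = moved (subst (λ y → φ y ≡ y) (trans (sym (fold-fixed fixed (toℕ (proj₁ (rep-∼ x))))) (proj₂ (rep-∼ x))) fixed)

      module _ (O : OrbitDecomposition p) where
        open OrbitDecomposition O

        mov : Fin #free × Fin p → Fin n
        mov (b , j) = fold (orb b) φ (toℕ j)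

        mov-injective : Injective _≡_ _≡_ mov
        mov-injective {_ , j} {_ , j′} eq = let b≡ , j≡ = orb-injective j j′ eq in cong₂ _,_ b≡ j≡

        mov-moved : ∀ s → φ (mov s) ≢ mov s
        mov-moved (b , j) = fold-moved (toℕ j) (orb-moved b)

        mov-index : ∀ x → φ x ≢ x → ∃ λ s → mov s ≡ x
        mov-index x moved = let b , j , eq = orb-index x moved in (b , j) , eq

        #fixed+#free*p≡n : #fixed + #free * p ≡ n
        #fixed+#free*p≡n = Perm.↔⇒≡ (Compose.inverse Fin.+↔⊎ (mk↔ₛ′ from⊎ to⊎ from-to to-from))
          where
          from⊎ : Fin #fixed ⊎ Fin (#free * p) → Fin n
          from⊎ (inj₁ i) = fix i
          from⊎ (inj₂ s) = mov (remQuot p s)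
          to⊎ : Fin n → Fin #fixed ⊎ Fin (#free * p)
          to⊎ x with φ x Fin.≟ x
          ... | yes fixed = inj₁ (proj₁ (fix-index x fixed))
          ... | no moved = inj₂ (uncurry combine (proj₁ (mov-index x moved)))
          from-to : ∀ x → from⊎ (to⊎ x) ≡ x
          from-to x with φ x Fin.≟ x
          ... | yes fixed = proj₂ (fix-index x fixed)
          ... | no moved = let (b , j) , eq = mov-index x moved in trans (cong mov (Fin.remQuot-combine b j)) eq
          to-from : ∀ s → to⊎ (from⊎ s) ≡ s
          to-from (inj₁ i) with φ (fix i) Fin.≟ fix i
          ... | yes fixed = cong inj₁ (fix-injective (proj₂ (fix-index (fix i) fixed)))
          ... | no moved = contradiction (fix-fixed i) moved
          to-from (inj₂ s) with φ (mov (remQuot {#free} p s)) Fin.≟ mov (remQuot {#free} p s)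
          ... | yes fixed = contradiction fixed (mov-moved (remQuot {#free} p s))
          ... | no moved = cong inj₂ (trans (cong (uncurry combine) (mov-injective {y = remQuot {#free} p s} (proj₂ (mov-index _ moved)))) (Fin.combine-remQuot {#free} p s))

        -- An admissible map is determined by its arbitrary values on the fixed points and
        -- on one representative of each free orbit.
        #admissible : HasSize AdmissibleMaps (#fixed ^ #fixed * (#free * p) ^ #free)
        #admissible = record
          { to = encode
          ; from = decode
          ; to-cong = λ {g} {h} → encode-cong {g} {h}
          ; from-cong = λ { refl _ → refl }
          ; inverse = (λ {c} {g} g≈ → trans (encode-cong {g} {decode c} g≈) (encode-decode c))
                    , (λ { {g} refl → decode-encode g })
          }
          where
          onFixed : Σ (Fin n → Fin n) Admissible → Fin #fixed → Fin #fixed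
          onFixed (g , adm) i = proj₁ (fix-index (g (fix i)) (trans (sym (Admissible.commutes adm (fix i))) (cong g (fix-fixed i))))

          onOrb : Σ (Fin n → Fin n) Admissible → Fin #free → Fin (#free * p)
          onOrb (g , adm) b = uncurry combine (proj₁ (mov-index (g (orb b)) (Admissible.moves adm (orb b) (orb-moved b))))

          fix-onFixed : ∀ g i → fix (onFixed g i) ≡ proj₁ g (fix i)
          fix-onFixed (g , adm) i = proj₂ (fix-index (g (fix i)) _)

          mov-onOrb : ∀ g b → mov (remQuot p (onOrb g b)) ≡ proj₁ g (orb b)
          mov-onOrb (g , adm) b = trans (cong mov (Fin.remQuot-combine _ _)) (proj₂ (mov-index (g (orb b)) _))

          encode : Σ (Fin n → Fin n) Admissible → Fin (#fixed ^ #fixed * (#free * p) ^ #free)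
          encode g = combine (funToFin (onFixed g)) (funToFin (onOrb g))

          encode-cong : ∀ {g h} → (∀ x → proj₁ g x ≡ proj₁ h x) → encode g ≡ encode h
          encode-cong {g} {h} g≗h = cong₂ combine
            (funToFin-cong λ i → fix-injective (trans (fix-onFixed g i) (trans (g≗h (fix i)) (sym (fix-onFixed h i)))))
            (funToFin-cong λ b → remQuot-injective p (mov-injective (trans (mov-onOrb g b) (trans (g≗h (orb b)) (sym (mov-onOrb h b))))))

          extend : (Fin #fixed → Fin #fixed) → (Fin #free → Fin (#free * p)) → Fin n → Fin n
          extend u v x with φ x Fin.≟ x
          ... | yes fixed = fix (u (proj₁ (fix-index x fixed)))
          ... | no moved = let (b , j) , _ = mov-index x moved in fold (mov (remQuot p (v b))) φ (toℕ j)

          module _ (u : Fin #fixed → Fin #fixed) (v : Fin #free → Fin (#free * p)) where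

            extend-fix : ∀ i → extend u v (fix i) ≡ fix (u i)
            extend-fix i with φ (fix i) Fin.≟ fix i
            ... | yes fixed = cong (fix ∘ u) (fix-injective (proj₂ (fix-index (fix i) fixed)))
            ... | no moved = contradiction (fix-fixed i) moved

            extend-mov : ∀ b m → extend u v (fold (orb b) φ m) ≡ fold (mov (remQuot p (v b))) φ m
            extend-mov b m with φ (fold (orb b) φ m) Fin.≟ fold (orb b) φ m
            ... | yes fixed = contradiction fixed (fold-moved m (orb-moved b))
            ... | no moved =
              let (b′ , j) , eq = mov-index (fold (orb b) φ m) moved
                  b′≡b , _ = orb-injective j (fromℕ< (m%n<n m p)) (trans eq (sym (trans
                    (cong (fold (orb b) φ) (Fin.toℕ-fromℕ< (m%n<n m p))) (fold-% (orb b) m))))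
              in trans (cong (λ b → fold (mov (remQuot p (v b))) φ (toℕ j)) b′≡b)
                   (fold-agree (orb-moved b) {toℕ j} {m}
                     (trans (cong (λ b → fold (orb b) φ (toℕ j)) (sym b′≡b)) eq) _)

            extend-admissible : Admissible (extend u v)
            extend-admissible = record { commutes = commutes ; moves = moves }
              where
              commutes : ∀ x → extend u v (φ x) ≡ φ (extend u v x)
              commutes x with φ x Fin.≟ x
              ... | yes fixed = trans (cong (extend u v) (trans fixed (sym (proj₂ (fix-index x fixed)))))
                      (trans (extend-fix _) (sym (fix-fixed _)))
              ... | no moved = let (b , j) , eq = mov-index x moved in
                      trans (cong (extend u v ∘ φ) (sym eq)) (extend-mov b (suc (toℕ j)))
              moves : ∀ x → φ x ≢ x → φ (extend u v x) ≢ extend u v x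
              moves x moved with (b , j) , refl ← mov-index x moved rewrite extend-mov b (toℕ j) =
                fold-moved (toℕ j) (mov-moved (remQuot p (v b)))

          decode : Fin (#fixed ^ #fixed * (#free * p) ^ #free) → Σ (Fin n → Fin n) Admissible
          decode c = extend u v , extend-admissible u v
            where
            u = finToFun (Fin.quotient {#fixed ^ #fixed} ((#free * p) ^ #free) c)
            v = finToFun (Fin.remainder {#fixed ^ #fixed} ((#free * p) ^ #free) c)

          encode-decode : ∀ c → encode (decode c) ≡ c
          encode-decode c = begin
            encode (decode c)
              ≡⟨ cong₂ (combine {#fixed ^ #fixed} {(#free * p) ^ #free})
                   (funToFin-cong λ i → fix-injective (trans (fix-onFixed (decode c) i) (extend-fix (finToFun c₁) (finToFun c₂) i)))
                   (funToFin-cong λ b → remQuot-injective p (mov-injective (trans (mov-onOrb (decode c) b) (extend-mov (finToFun c₁) (finToFun c₂) b 0)))) ⟩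
            combine (funToFin {#fixed} (finToFun c₁)) (funToFin {#free} (finToFun c₂))
              ≡⟨ cong₂ (combine {#fixed ^ #fixed} {(#free * p) ^ #free}) (Fin.funToFin-finToFin {#fixed} c₁) (Fin.funToFin-finToFin {#free} c₂) ⟩
            combine c₁ c₂
              ≡⟨ Fin.combine-remQuot {#fixed ^ #fixed} ((#free * p) ^ #free) c ⟩
            c ∎
            where
            open ≡-Reasoning
            c₁ = Fin.quotient {#fixed ^ #fixed} ((#free * p) ^ #free) c
            c₂ = Fin.remainder {#fixed ^ #fixed} ((#free * p) ^ #free) c

          commutes-fold : ∀ {g} → Admissible g → ∀ x m → g (fold x φ m) ≡ fold (g x) φ m
          commutes-fold adm x zero = refl
          commutes-fold adm x (suc m) = trans (Admissible.commutes adm (fold x φ m)) (cong φ (commutes-fold adm x m))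

          decode-encode : ∀ g x → proj₁ (decode (encode g)) x ≡ proj₁ g x
          decode-encode g@(g₀ , adm) x with φ x Fin.≟ x
          ... | yes fixed = let i , eq = fix-index x fixed in trans (cong fix (trans
                  (cong (λ c → finToFun {#fixed} {#fixed} (proj₁ c) i) (Fin.remQuot-combine (funToFin (onFixed g)) (funToFin (onOrb g))))
                  (Fin.finToFun-funToFin (onFixed g) i))) (trans (fix-onFixed g i) (cong g₀ eq))
          ... | no moved = let (b , j) , eq = mov-index x moved in trans (cong (λ y → fold y φ (toℕ j)) (trans
                  (cong (mov ∘ remQuot p) (trans
                    (cong (λ c → finToFun {#free * p} {#free} (proj₂ c) b) (Fin.remQuot-combine (funToFin (onFixed g)) (funToFin (onOrb g))))
                    (Fin.finToFun-funToFin (onOrb g) b)))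
                  (mov-onOrb g b))) (trans (sym (commutes-fold adm (orb b) (toℕ j))) (cong g₀ eq))

open Orbits

module Polynomial {c ℓ : Level} (R : CommutativeRing c ℓ) where

  open CommutativeRing R hiding (zero)
  open RawMonoidDefs +-rawMonoid using (sum)
  open Exp semiring using (_^_; ^-congˡ; ^-congʳ; ^-homo-*)
  open Sum +-commutativeMonoid using (sum-cong-≋; ∑-distrib-+)
  open SemiringSum semiring using (*-distribˡ-sum)
  open SetoidReasoning setoid
  open SemiringSolver commutativeSemiring using (solve; _:+_; _:*_; _:=_; con)

  eval : ∀ {n} → Vector Carrier n → Carrier → Carrier
  eval a x = sum λ i → a i * x ^ toℕ i

  eval-cong : ∀ {n} (a : Vector Carrier n) {x y} → x ≈ y → eval a x ≈ eval a y
  eval-cong {n} a x≈y = sum-cong-≋ {n} λ i → *-congˡ {a i} (^-congˡ (toℕ i) x≈y)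

  eval-- : ∀ {k} (a b : Vector Carrier k) x → eval (λ i → a i - b i) x ≈ eval a x - eval b x
  eval-- a b x = GroupProperties.∙-cancelʳ +-group (eval b x) _ _ (begin
    eval (λ i → a i - b i) x + eval b x                          ≈⟨ ∑-distrib-+ (λ i → (a i - b i) * x ^ toℕ i) (λ i → b i * x ^ toℕ i) ⟨
    sum (λ i → (a i - b i) * x ^ toℕ i + b i * x ^ toℕ i)        ≈⟨ sum-cong-≋ (λ i → trans (sym (distribʳ (x ^ toℕ i) (a i - b i) (b i))) (*-congʳ (cancelʳ (a i) (b i)))) ⟩
    eval a x                                                     ≈⟨ cancelʳ (eval a x) (eval b x) ⟨
    eval a x - eval b x + eval b x                               ∎)
    where
    cancelʳ : ∀ a b → a - b + b ≈ a
    cancelʳ a b = trans (+-assoc a (- b) b) (trans (+-congˡ (-‿inverseˡ b)) (+-identityʳ a))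

  eval-suc : ∀ {n} (a : Vector Carrier (suc n)) x → eval a x ≈ head a + x * eval (tail a) x
  eval-suc a x = +-cong (*-identityʳ (head a)) (begin
    sum (λ i → tail a i * (x * x ^ toℕ i))   ≈⟨ sum-cong-≋ (λ i → swap (tail a i) x (x ^ toℕ i)) ⟩
    sum (λ i → x * (tail a i * x ^ toℕ i))   ≈⟨ *-distribˡ-sum x (λ i → tail a i * x ^ toℕ i) ⟨
    x * eval (tail a) x                      ∎)
    where
    swap : ∀ a x y → a * (x * y) ≈ x * (a * y)
    swap = solve 3 (λ a x y → a :* (x :* y) := x :* (a :* y)) refl

  -- Synthetic division by X − c.
  quotient : ∀ {n} → Carrier → Vector Carrier (suc n) → Vector Carrier n
  quotient {zero} c a = []
  quotient {suc n} c a = eval (tail a) c ∷ quotient c (tail a)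

  eval-quotient : ∀ {n} c (a : Vector Carrier (suc n)) x →
                  eval a x ≈ eval a c + (x - c) * eval (quotient c a) x
  eval-quotient {zero} c a x = sym (trans (+-congˡ (zeroʳ (x - c))) (+-identityʳ _))
  eval-quotient {suc n} c a x = begin
    eval a x                                             ≈⟨ eval-suc a x ⟩
    head a + x * eval (tail a) x                         ≈⟨ +-congˡ (*-cong x≈c+d (eval-quotient c (tail a) x)) ⟩
    head a + (c + d) * (e + d * eval q x)                ≈⟨ rearrange (head a) c d e (eval q x) ⟩
    head a + c * e + d * (e + (c + d) * eval q x)        ≈⟨ +-congˡ (*-congˡ (+-congˡ (*-congʳ x≈c+d))) ⟨
    head a + c * e + d * (e + x * eval q x)              ≈⟨ +-cong (eval-suc a c) (*-congˡ (eval-suc (quotient c a) x)) ⟨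
    eval a c + d * eval (quotient c a) x                 ∎
    where
    d = x - c
    e = eval (tail a) c
    q = quotient c (tail a)
    x≈c+d : x ≈ c + d
    x≈c+d = begin
      x              ≈⟨ +-identityʳ x ⟨
      x + 0#         ≈⟨ +-congˡ (-‿inverseʳ c) ⟨
      x + (c - c)    ≈⟨ solve 3 (λ x c n → x :+ (c :+ n) := c :+ (x :+ n)) refl x c (- c) ⟩
      c + (x - c)    ∎
    rearrange : ∀ a c d e q → a + (c + d) * (e + d * q) ≈ a + c * e + d * (e + (c + d) * q)
    rearrange = solve 5 (λ a c d e q →
      a :+ (c :+ d) :* (e :+ d :* q) := a :+ c :* e :+ d :* (e :+ (c :+ d) :* q)) refl

  quotient≈0⇒≈0 : ∀ {n} c (a : Vector Carrier (suc n)) → eval a c ≈ 0# →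
                  (∀ i → quotient c a i ≈ 0#) → ∀ i → a i ≈ 0#
  quotient≈0⇒≈0 {n} c a ac≈0 q≈0 zero = begin
    head a                       ≈⟨ +-identityʳ (head a) ⟨
    head a + 0#                  ≈⟨ +-congˡ (trans (*-congˡ (tail≈0 n a q≈0)) (zeroʳ c)) ⟨
    head a + c * eval (tail a) c ≈⟨ eval-suc a c ⟨
    eval a c                     ≈⟨ ac≈0 ⟩
    0#                           ∎
    where
    tail≈0 : ∀ n (a : Vector Carrier (suc n)) → (∀ i → quotient c a i ≈ 0#) → eval (tail a) c ≈ 0#
    tail≈0 zero a _ = refl
    tail≈0 (suc n) a q≈0 = q≈0 zero
  quotient≈0⇒≈0 {suc n} c a ac≈0 q≈0 (suc i) = quotient≈0⇒≈0 c (tail a) (q≈0 zero) (q≈0 ∘ suc) i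

  linear* : ∀ {n} → Carrier → Carrier → Vector Carrier n → Vector Carrier (suc n)
  linear* {zero} c y b = y ∷ []
  linear* {suc n} c y b = (y + (- c) * head b) ∷ linear* c (head b) (tail b)

  eval-linear* : ∀ {n} c y (b : Vector Carrier n) x → eval (linear* c y b) x ≈ (x - c) * eval b x + y
  eval-linear* {zero} c y b x = solve 2 (λ y d → y :* con 1 :+ con 0 := d :* con 0 :+ y) refl y (x - c)
  eval-linear* {suc n} c y b x = begin
    eval (linear* c y b) x                                            ≈⟨ eval-suc (linear* c y b) x ⟩
    y + (- c) * head b + x * eval (linear* c (head b) (tail b)) x     ≈⟨ +-congˡ (*-congˡ (eval-linear* c (head b) (tail b) x)) ⟩
    y + (- c) * head b + x * ((x - c) * eval (tail b) x + head b)     ≈⟨ rearrange y (- c) (head b) x (eval (tail b) x) ⟩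
    (x - c) * (head b + x * eval (tail b) x) + y                      ≈⟨ +-congʳ (*-congˡ (eval-suc b x)) ⟨
    (x - c) * eval b x + y                                            ∎
    where
    rearrange : ∀ y n b x e → y + n * b + x * ((x + n) * e + b) ≈ (x + n) * (b + x * e) + y
    rearrange = solve 5 (λ y n b x e →
      y :+ n :* b :+ x :* ((x :+ n) :* e :+ b) := (x :+ n) :* (b :+ x :* e) :+ y) refl

  Monic : ℕ → (Carrier → Carrier) → Set _
  Monic d f = ∃ λ (a : Vector Carrier (suc d)) → a (fromℕ d) ≈ 1# × (∀ x → f x ≈ eval a x)

  monic-1 : Monic 0 (λ _ → 1#)
  monic-1 = (1# ∷ []) , refl , λ _ → sym (trans (+-identityʳ _) (*-identityʳ 1#))

  monic-horner : ∀ {d f} c → Monic d f → Monic (suc d) (λ x → c + x * f x)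
  monic-horner c (a , top , f≈) = (c ∷ a) , top , λ x → trans (+-congˡ (*-congˡ (f≈ x))) (sym (eval-suc (c ∷ a) x))

  monic-cong : ∀ {d f g} → (∀ x → g x ≈ f x) → Monic d f → Monic d g
  monic-cong g≈f (a , top , f≈) = a , top , λ x → trans (g≈f x) (f≈ x)

  monic-^* : ∀ {d f} e → Monic d f → Monic (e ℕ.+ d) (λ x → x ^ e * f x)
  monic-^* zero m = monic-cong (λ x → *-identityˡ _) m
  monic-^* (suc e) m = monic-cong (λ x → trans (*-assoc x (x ^ e) _) (sym (+-identityˡ _))) (monic-horner 0# (monic-^* e m))

  geometric : ℕ → ℕ → Carrier → Carrier
  geometric e zero x = 1#
  geometric e (suc j) x = 1# + x ^ e * geometric e j x

  geometric-monic : ∀ e j → Monic (j ℕ.* suc e) (geometric (suc e) j)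
  geometric-monic e zero = monic-1
  geometric-monic e (suc j) = monic-cong (λ x → +-congˡ (*-assoc x (x ^ e) _))
    (monic-horner 1# (monic-^* e (geometric-monic e j)))

  geometric-sum : ∀ e j x → (x ^ suc e - x) * geometric e j x ≈ x ^ (j ℕ.* e ℕ.+ suc e) - x
  geometric-sum e zero x = *-identityʳ _
  geometric-sum e (suc j) x = begin
    (x * y - x) * (1# + y * g)              ≈⟨ solve 3 (λ d y g → d :* (con 1 :+ y :* g) := d :+ y :* (d :* g)) refl (x * y - x) y g ⟩
    (x * y - x) + y * ((x * y - x) * g)     ≈⟨ +-congˡ (*-congˡ (geometric-sum e j x)) ⟩
    (x * y - x) + y * (z - x)               ≈⟨ +-congˡ (distribˡ y z (- x)) ⟩
    (x * y - x) + (y * z + y * - x)         ≈⟨ solve 4 (λ a b c d → (a :+ b) :+ (c :+ d) := (a :+ d) :+ (c :+ b)) refl (x * y) (- x) (y * z) (y * - x) ⟩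
    (x * y + y * - x) + (y * z - x)         ≈⟨ +-congʳ (trans (+-congʳ (*-comm x y)) (trans (sym (distribˡ y x (- x))) (trans (*-congˡ (-‿inverseʳ x)) (zeroʳ y)))) ⟩
    0# + (y * z - x)                        ≈⟨ +-identityˡ _ ⟩
    y * z - x                               ≈⟨ +-congʳ (^-homo-* x e (j ℕ.* e ℕ.+ suc e)) ⟨
    x ^ (e ℕ.+ (j ℕ.* e ℕ.+ suc e)) - x     ≈⟨ +-congʳ (^-congʳ x (≡.sym (ℕ.+-assoc e (j ℕ.* e) (suc e)))) ⟩
    x ^ (suc j ℕ.* e ℕ.+ suc e) - x         ∎
    where
    y = x ^ e
    g = geometric e j x
    z = x ^ (j ℕ.* e ℕ.+ suc e)

  module Roots (1≉0 : ¬ 1# ≈ 0#) (cancel : ∀ {x y} → ¬ x ≈ 0# → x * y ≈ 0# → y ≈ 0#) where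

    x-y≈0⇒x≈y : ∀ {x y} → x - y ≈ 0# → x ≈ y
    x-y≈0⇒x≈y {x} {y} = GroupProperties.x∙y⁻¹≈ε⇒x≈y +-group x y

    roots⇒≈0 : ∀ {n} (a : Vector Carrier n) (r : Fin n → Carrier) → (∀ {i j} → r i ≈ r j → i ≡ j) →
               (∀ i → eval a (r i) ≈ 0#) → ∀ i → a i ≈ 0#
    roots⇒≈0 {suc n} a r r-inj root = quotient≈0⇒≈0 (r zero) a (root zero)
      (roots⇒≈0 (quotient (r zero) a) (r ∘ suc) (Fin.suc-injective ∘ r-inj) λ i → cancel (apart i) (begin
        (r (suc i) - r zero) * eval (quotient (r zero) a) (r (suc i))   ≈⟨ +-identityˡ _ ⟨
        0# + (r (suc i) - r zero) * eval (quotient (r zero) a) (r (suc i))   ≈⟨ +-congʳ (root zero) ⟨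
        eval a (r zero) + (r (suc i) - r zero) * eval (quotient (r zero) a) (r (suc i))   ≈⟨ eval-quotient (r zero) a (r (suc i)) ⟨
        eval a (r (suc i))   ≈⟨ root (suc i) ⟩
        0# ∎))
      where
      apart : ∀ i → ¬ r (suc i) - r zero ≈ 0#
      apart i eq with () ← r-inj (x-y≈0⇒x≈y eq)

    #roots≤degree : ∀ {d f m} → Monic d f → (r : Fin m → Carrier) → (∀ {i j} → r i ≈ r j → i ≡ j) →
                    (∀ i → f (r i) ≈ 0#) → m ≤ d
    #roots≤degree {d} {f} {m} (a , top , f≈) r r-inj root with m ℕ.≤? d
    ... | yes m≤d = m≤d
    ... | no m≰d = contradiction (trans (sym top) (roots⇒≈0 a (λ i → r (inject≤ i d<m))
            (λ eq → Fin.inject≤-injective d<m d<m _ _ (r-inj eq)) (λ i → trans (sym (f≈ _)) (root _)) (fromℕ d))) 1≉0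
      where d<m = ℕ.≰⇒> m≰d

    -- Newton interpolation: peel off one node and interpolate the divided differences.
    interpolate : (∀ x → ¬ x ≈ 0# → ∃ λ y → x * y ≈ 1#) →
                  ∀ {n} (r : Fin n → Carrier) → (∀ {i j} → r i ≈ r j → i ≡ j) → (y : Fin n → Carrier) →
                  ∃ λ (a : Vector Carrier n) → ∀ i → eval a (r i) ≈ y i
    interpolate inv {zero} r r-inj y = [] , λ ()
    interpolate inv {suc n} r r-inj y = linear* (r zero) (y zero) b , λ where
        zero → begin
          eval (linear* (r zero) (y zero) b) (r zero)        ≈⟨ eval-linear* (r zero) (y zero) b (r zero) ⟩
          (r zero - r zero) * eval b (r zero) + y zero      ≈⟨ at-root (r zero) (eval b (r zero)) (y zero) ⟩
          y zero                                            ∎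
        (suc i) → begin
          eval (linear* (r zero) (y zero) b) (r (suc i))         ≈⟨ eval-linear* (r zero) (y zero) b (r (suc i)) ⟩
          (r (suc i) - r zero) * eval b (r (suc i)) + y zero    ≈⟨ +-congʳ (*-congˡ (b-eq i)) ⟩
          (r (suc i) - r zero) * (inverse i * (y (suc i) - y zero)) + y zero   ≈⟨ +-congʳ (*-assoc _ _ _) ⟨
          (r (suc i) - r zero) * inverse i * (y (suc i) - y zero) + y zero   ≈⟨ +-congʳ (*-congʳ (proj₂ (inv _ (apart i)))) ⟩
          1# * (y (suc i) - y zero) + y zero    ≈⟨ at-1 (y (suc i)) (y zero) ⟩
          y (suc i)                                              ∎
      where
      apart : ∀ i → ¬ r (suc i) - r zero ≈ 0#
      apart i eq with () ← r-inj (x-y≈0⇒x≈y eq)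
      inverse : Fin n → Carrier
      inverse i = proj₁ (inv (r (suc i) - r zero) (apart i))
      rest = interpolate inv (r ∘ suc) (Fin.suc-injective ∘ r-inj) (λ i → inverse i * (y (suc i) - y zero))
      b = proj₁ rest
      b-eq = proj₂ rest
      at-root : ∀ r e y → (r - r) * e + y ≈ y
      at-root r e y = trans (+-congʳ (trans (*-congʳ (-‿inverseʳ r)) (zeroˡ e))) (+-identityˡ y)
      at-1 : ∀ a y → 1# * (a - y) + y ≈ a
      at-1 a y = trans (+-congʳ (*-identityˡ (a - y)))
        (trans (+-assoc a (- y) y) (trans (+-congˡ (-‿inverseˡ y)) (+-identityʳ a)))

prime>1 : ∀ {p} → Prime p → 1 < p
prime>1 pr = ℕ.nonTrivial⇒n>1 _ {{prime⇒nonTrivial pr}}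

primePower>1 : ∀ {q} → IsPrimePower q → 1 < q
primePower>1 (r , k , r-prime , ≡.refl) = ℕ.≤-trans (prime>1 r-prime)
  (ℕ.m≤m*n r (r ℕ.^ k) {{ℕ.m^n≢0 r k {{prime⇒nonZero r-prime}}}})

prime∤! : ∀ {p} → Prime p → ∀ {k} → k < p → ¬ p ∣ k !
prime∤! pr {zero} _ p∣1 = ℕ.≤⇒≯ (∣⇒≤ p∣1) (prime>1 pr)
prime∤! pr {suc k} k<p p∣ = [ (λ p∣k → ℕ.≤⇒≯ (∣⇒≤ p∣k) k<p) , prime∤! pr (ℕ.<-trans (ℕ.n<1+n k) k<p) ]′
  (euclidsLemma (suc k) (k !) pr p∣)

prime∣C : ∀ {p} → Prime p → ∀ {k} → 0 < k → k < p → p ∣ p C k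
prime∣C {p@(suc p-1)} pr {k} 0<k k<p with euclidsLemma (p C k) (k ! ℕ.* (p ∸ k) !) pr p∣product
  where
  instance _ = ℕ.m*n≢0 (k !) ((p ∸ k) !) {{k ℕ.!≢0}} {{(p ∸ k) ℕ.!≢0}}
  p∣product : p ∣ (p C k) ℕ.* (k ! ℕ.* (p ∸ k) !)
  p∣product = ≡.subst (p ∣_) (≡.sym (≡.trans (≡.cong (ℕ._* (k ! ℕ.* (p ∸ k) !)) (nCk≡n!/k![n-k]! (ℕ.<⇒≤ k<p)))
    (m/n*n≡m (k![n∸k]!∣n! (ℕ.<⇒≤ k<p))))) (m∣m*n (p-1 !))
... | inj₁ p∣C = p∣C
... | inj₂ p∣k!*[p∸k]! = ⊥-elim ([ prime∤! pr k<p , prime∤! pr (ℕ.∸-monoʳ-< 0<k (ℕ.<⇒≤ k<p)) ]′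
      (euclidsLemma (k !) ((p ∸ k) !) pr p∣k!*[p∸k]!))

[1+e]^[1+p]≡1+e+Ne : ∀ e p → ∃ λ N → N ℕ.* e ℕ.+ suc e ≡ suc e ℕ.^ suc p
[1+e]^[1+p]≡1+e+Ne e zero = 0 , ≡.sym (ℕ.*-identityʳ (suc e))
[1+e]^[1+p]≡1+e+Ne e (suc p) with N , eq ← [1+e]^[1+p]≡1+e+Ne e p =
  suc e ℕ.* suc N , ≡.trans (expand e N) (≡.cong (suc e ℕ.*_) eq)
  where
  expand : ∀ e N → suc e ℕ.* suc N ℕ.* e ℕ.+ suc e ≡ suc e ℕ.* (N ℕ.* e ℕ.+ suc e)
  expand = solve-∀

module Field {c ℓ₁ ℓ₂ : Level} (q m : ℕ) (K : FiniteField c ℓ₁ ℓ₂ (q ℕ.^ m)) where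

  open CommutativeRing (FiniteField.commutativeRing K) renaming (setoid to K-setoid) hiding (zero) public
  open Exp semiring using (_^_; ^-congˡ; ^-congʳ; ^-homo-*; ^-assocʳ) public
  open CommutativeExp commutativeSemiring using (^-distrib-*) public
  open Mult semiring using (×-congʳ; ×-congˡ; ×-assocˡ; ×-assoc-*; ×1-homo-*)
    renaming (_×_ to _·_; ×-homo-1 to 1·_)
  open Sum +-commutativeMonoid using (sum; sum-cong-≋; sum-permute; sum-replicate; sum-replicate-zero; ∑-distrib-+; sum-init-last)
  open Sum *-commutativeMonoid using () renaming
    (sum to prod; sum-cong-≋ to prod-cong; sum-permute to prod-permute; sum-replicate to prod-replicate; sum-replicate-zero to prod-replicate-1;
     ∑-distrib-+ to prod-distrib; sum-remove to prod-remove)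
  open SetoidReasoning K-setoid
  open IsSubfield
  open SemiringSolver commutativeSemiring using (solve; _:+_; _:*_; _:=_; con)
  open Polynomial (FiniteField.commutativeRing K) using (eval; eval-cong; eval--; module Roots; monic-1; monic-horner; monic-^*; geometric; geometric-monic; geometric-sum) public

  private
    module H = HeytingField (FiniteField.heytingField K)
    n = q ℕ.^ m

  ι : Carrier → Fin n
  ι = Inverse.to (FiniteField.size K)

  κ : Fin n → Carrier
  κ = Inverse.from (FiniteField.size K)

  ι-cong : ∀ {x y} → x ≈ y → ι x ≡ ι y
  ι-cong = Inverse.to-cong (FiniteField.size K)

  κι : ∀ x → κ (ι x) ≈ x
  κι = Inverse.strictlyInverseʳ (FiniteField.size K)

  ικ : ∀ i → ι (κ i) ≡ i
  ικ = Inverse.strictlyInverseˡ (FiniteField.size K)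

  ι-injective : ∀ {x y} → ι x ≡ ι y → x ≈ y
  ι-injective {x} {y} eq = trans (sym (κι x)) (trans (reflexive (≡.cong κ eq)) (κι y))

  κ-injective : ∀ {i j} → κ i ≈ κ j → i ≡ j
  κ-injective {i} {j} eq = ≡.trans (≡.sym (ικ i)) (≡.trans (ι-cong eq) (ικ j))

  _≟_ : Binary.Decidable _≈_
  x ≟ y = map′ ι-injective ι-cong (ι x Fin.≟ ι y)

  1≉0 : ¬ 1# ≈ 0#
  1≉0 1≈0 = proj₂ (H.tight 0# 0#) refl (H.invertible⇒#
    (0# , trans (zeroˡ (0# - 0#)) (sym 1≈0) , trans (zeroʳ (0# - 0#)) (sym 1≈0)))

  invertible : ∀ x → ¬ x ≈ 0# → ∃ λ y → x * y ≈ 1#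
  invertible x x≉0 with Fin.any? (λ i → (x * κ i) ≟ 1#)
  ... | yes (i , eq) = κ i , eq
  ... | no ¬inv = contradiction (proj₁ (H.tight x 0#) x¬#0) x≉0
    where
    x¬#0 : ¬ x H.# 0#
    x¬#0 x#0 with y , _ , eq ← H.#⇒invertible x#0 = ¬inv (ι y , (begin
      x * κ (ι y)       ≈⟨ *-congˡ (κι y) ⟩
      x * y             ≈⟨ *-congʳ (trans (sym (+-identityʳ x)) (+-congˡ (sym (GroupProperties.ε⁻¹≈ε +-group)))) ⟩
      (x - 0#) * y      ≈⟨ eq ⟩
      1#                ∎))

  *-cancelˡ-≉0 : ∀ {x y z} → ¬ x ≈ 0# → x * y ≈ x * z → y ≈ z
  *-cancelˡ-≉0 {x} {y} {z} x≉0 eq = trans (sym (undo y)) (trans (*-congˡ eq) (undo z))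
    where
    x⁻¹ = proj₁ (invertible x x≉0)
    undo : ∀ y → x⁻¹ * (x * y) ≈ y
    undo y = trans (sym (*-assoc x⁻¹ x y)) (trans (*-congʳ (trans (*-comm x⁻¹ x) (proj₂ (invertible x x≉0)))) (*-identityˡ y))

  cancel : ∀ {x y} → ¬ x ≈ 0# → x * y ≈ 0# → y ≈ 0#
  cancel {x} x≉0 xy≈0 = *-cancelˡ-≉0 x≉0 (trans xy≈0 (sym (zeroʳ x)))

  open Roots 1≉0 (λ {x} {y} → cancel {x} {y}) public

  0^ : ∀ k → .{{NonZero k}} → 0# ^ k ≈ 0#
  0^ (suc k) = zeroˡ _

  1^ : ∀ k → 1# ^ k ≈ 1#
  1^ zero = refl
  1^ (suc k) = trans (*-identityˡ _) (1^ k)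

  prod-≉0 : ∀ {k} (t : Vector Carrier k) → (∀ i → ¬ t i ≈ 0#) → ¬ prod t ≈ 0#
  prod-≉0 {zero} t _ = 1≉0
  prod-≉0 {suc k} t t≉0 eq = prod-≉0 (tail t) (t≉0 ∘ suc) (cancel (t≉0 zero) eq)

  -- Multiplication by x ≠ 0 permutes S and fixes 0.  Replacing 0 by 1 in the product of all
  -- elements of S, both sides of xˢ ∏ = x ∏ compare that product with its permuted copy.
  x^size≈x : ∀ {S s} → IsSubfield q m K S → HasSize (subset q m K S) s → ∀ {x} → S x → x ^ s ≈ x
  x^size≈x {S} {zero} sub size {x} Sx = contradiction (Inverse.to size (x , Sx)) Fin.¬Fin0
  x^size≈x {S} {s@(suc _)} sub size {x} Sx with x ≟ 0#
  ... | yes x≈0 = trans (^-congˡ s x≈0) (trans (0^ s) (sym x≈0))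
  ... | no x≉0 = *-cancelˡ-≉0 (prod-≉0 e′ e′≉0) (begin
      prod e′ * x ^ s                        ≈⟨ *-comm _ _ ⟩
      x ^ s * prod e′                        ≈⟨ *-congʳ (prod-replicate s) ⟨
      prod (λ (_ : Fin s) → x) * prod e′     ≈⟨ prod-distrib (λ _ → x) e′ ⟨
      prod (λ i → x * e′ i)                  ≈⟨ prod-cong shift ⟩
      prod (λ i → w i * e′ (π i))            ≈⟨ prod-distrib w (e′ ∘ π) ⟩
      prod w * prod (e′ ∘ π)                 ≈⟨ *-cong prod-w (sym (prod-permute e′ (Perm.permutation π π⁻¹ ππ⁻¹ π⁻¹π))) ⟩
      x * prod e′                            ≈⟨ *-comm _ _ ⟩
      prod e′ * x                            ∎)
    where
    to = Inverse.to size
    from = Inverse.from size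
    e : Fin s → Carrier
    e i = proj₁ (from i)
    e-to : ∀ a → e (to a) ≈ proj₁ a
    e-to = Inverse.strictlyInverseʳ size
    e-injective : ∀ {i j} → e i ≈ e j → i ≡ j
    e-injective {i} {j} eq = ≡.trans (≡.sym (Inverse.strictlyInverseˡ size i))
      (≡.trans (Inverse.to-cong size eq) (Inverse.strictlyInverseˡ size j))
    y = proj₁ (invertible x x≉0)
    xy≈1 = proj₂ (invertible x x≉0)
    π π⁻¹ : Fin s → Fin s
    π i = to (x * e i , *-closed sub Sx (proj₂ (from i)))
    π⁻¹ i = to (y * e i , *-closed sub (inv-closed sub Sx xy≈1) (proj₂ (from i)))
    ππ⁻¹ : ∀ i → π (π⁻¹ i) ≡ i
    ππ⁻¹ i = e-injective (begin
      e (π (π⁻¹ i))     ≈⟨ e-to _ ⟩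
      x * e (π⁻¹ i)     ≈⟨ *-congˡ (e-to _) ⟩
      x * (y * e i)     ≈⟨ *-assoc x y (e i) ⟨
      x * y * e i       ≈⟨ *-congʳ xy≈1 ⟩
      1# * e i          ≈⟨ *-identityˡ (e i) ⟩
      e i               ∎)
    π⁻¹π : ∀ i → π⁻¹ (π i) ≡ i
    π⁻¹π i = e-injective (begin
      e (π⁻¹ (π i))     ≈⟨ e-to _ ⟩
      y * e (π i)       ≈⟨ *-congˡ (e-to _) ⟩
      y * (x * e i)     ≈⟨ *-assoc y x (e i) ⟨
      y * x * e i       ≈⟨ *-congʳ (trans (*-comm y x) xy≈1) ⟩
      1# * e i          ≈⟨ *-identityˡ (e i) ⟩
      e i               ∎)
    e′ w : Fin s → Carrier
    e′ i with e i ≟ 0#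
    ... | yes _ = 1#
    ... | no _ = e i
    w i with e i ≟ 0#
    ... | yes _ = x
    ... | no _ = 1#
    e′≉0 : ∀ i → ¬ e′ i ≈ 0#
    e′≉0 i with e i ≟ 0#
    ... | yes _ = 1≉0
    ... | no ei≉0 = ei≉0
    shift : ∀ i → x * e′ i ≈ w i * e′ (π i)
    shift i with e i ≟ 0# | e (π i) ≟ 0#
    ... | yes _ | yes _ = refl
    ... | yes ei≈0 | no eπi≉0 = contradiction (trans (e-to _) (trans (*-congˡ ei≈0) (zeroʳ x))) eπi≉0
    ... | no ei≉0 | yes eπi≈0 = contradiction (cancel x≉0 (trans (sym (e-to _)) eπi≈0)) ei≉0
    ... | no _ | no _ = trans (sym (e-to _)) (sym (*-identityˡ _))
    z = to (0# , 0-closed sub)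
    w-z : w z ≈ x
    w-z with e z ≟ 0#
    ... | yes _ = refl
    ... | no ez≉0 = contradiction (e-to _) ez≉0
    w-≢z : ∀ i → i ≢ z → w i ≈ 1#
    w-≢z i i≢z with e i ≟ 0#
    ... | yes ei≈0 = contradiction (e-injective (trans ei≈0 (sym (e-to _)))) i≢z
    ... | no _ = refl
    prod-w : prod w ≈ x
    prod-w = begin
      prod w                       ≈⟨ prod-remove w ⟩
      w z * prod (removeAt w z)    ≈⟨ *-cong w-z (prod-cong (λ i → w-≢z (punchIn z i) (Fin.punchInᵢ≢i z i))) ⟩
      x * prod {ℕ.pred s} (λ _ → 1#)  ≈⟨ *-congˡ (prod-replicate-1 (ℕ.pred s)) ⟩
      x * 1#                       ≈⟨ *-identityʳ x ⟩
      x                            ∎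

  whole : Pred Carrier ℓ₁
  whole _ = Lift ℓ₁ ⊤

  whole-isSubfield : IsSubfield q m K whole
  whole-isSubfield = record
    { resp = _ ; 0-closed = _ ; 1-closed = _ ; +-closed = _ ; *-closed = _ ; neg-closed = _ ; inv-closed = _ }

  whole-size : HasSize (subset q m K whole) n
  whole-size = record
    { to = ι ∘ proj₁ ; from = λ i → κ i , _ ; to-cong = ι-cong ; from-cong = λ { ≡.refl → refl }
    ; inverse = Inverse.inverseˡ (FiniteField.size K) , Inverse.inverseʳ (FiniteField.size K) }

  x^n≈x : ∀ x → x ^ n ≈ x
  x^n≈x x = x^size≈x whole-isSubfield whole-size {x} _

  -- Translation by 1 permutes K, so the sum of all elements absorbs n · 1.
  n·1≈0 : n · 1# ≈ 0#
  n·1≈0 = GroupProperties.∙-cancelʳ +-group (sum κ) (n · 1#) 0# (begin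
    n · 1# + sum κ                    ≈⟨ +-congʳ (sum-replicate n) ⟨
    sum (λ (_ : Fin n) → 1#) + sum κ  ≈⟨ ∑-distrib-+ (λ _ → 1#) κ ⟨
    sum (λ i → 1# + κ i)              ≈⟨ sum-cong-≋ (λ i → κι (1# + κ i)) ⟨
    sum (λ i → κ (ι (1# + κ i)))      ≈⟨ sum-permute κ (Perm.permutation _ (λ i → ι (- 1# + κ i)) (undo 1# (- 1#) (-‿inverseʳ 1#)) (undo (- 1#) 1# (-‿inverseˡ 1#))) ⟨
    sum κ                             ≈⟨ +-identityˡ (sum κ) ⟨
    0# + sum κ                        ∎)
    where
    undo : ∀ a b → a + b ≈ 0# → ∀ i → ι (a + κ (ι (b + κ i))) ≡ i
    undo a b a+b≈0 i = κ-injective (begin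
      κ (ι (a + κ (ι (b + κ i))))   ≈⟨ κι _ ⟩
      a + κ (ι (b + κ i))           ≈⟨ +-congˡ (κι _) ⟩
      a + (b + κ i)                 ≈⟨ +-assoc a b (κ i) ⟨
      a + b + κ i                   ≈⟨ +-congʳ a+b≈0 ⟩
      0# + κ i                      ≈⟨ +-identityˡ (κ i) ⟩
      κ i                           ∎)

  interpolation : ∀ (f : Func K-setoid K-setoid) → ∃ λ (a : Vector Carrier n) → ∀ x → f ⟨$⟩ x ≈ eval a x
  interpolation f with a , a-eq ← interpolate invertible κ κ-injective (λ i → f ⟨$⟩ κ i) = a , λ x → begin
    f ⟨$⟩ x            ≈⟨ Func.cong f (κι x) ⟨
    f ⟨$⟩ κ (ι x)      ≈⟨ a-eq (ι x) ⟨
    eval a (κ (ι x))   ≈⟨ eval-cong a (κι x) ⟩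
    eval a x           ∎

  module Frobenius (q-pp : IsPrimePower q) where

    private
      r = proj₁ q-pp
      k = proj₁ (proj₂ q-pp)
      r-prime = proj₁ (proj₂ (proj₂ q-pp))
      q≡r^ = proj₂ (proj₂ (proj₂ q-pp))
      instance
        q≢0 : NonZero q
        q≢0 = primePower⇒nonZero q-pp

    r·1≈0 : r · 1# ≈ 0#
    r·1≈0 = root (suc k ℕ.* m) (trans (×-congˡ (≡.trans (≡.sym (ℕ.^-*-assoc r (suc k) m)) (≡.cong (ℕ._^ m) (≡.sym q≡r^)))) n·1≈0)
      where
      root : ∀ e → (r ℕ.^ e) · 1# ≈ 0# → r · 1# ≈ 0#
      root zero eq = contradiction (trans (sym (1· 1#)) eq) 1≉0
      root (suc e) eq with (r · 1#) ≟ 0#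
      ... | yes r≈0 = r≈0
      ... | no r≉0 = root e (cancel r≉0 (trans (sym (×1-homo-* r (r ℕ.^ e))) eq))

    r∣k⇒k·x≈0 : ∀ {k} → r ∣ k → ∀ x → k · x ≈ 0#
    r∣k⇒k·x≈0 {k} (divides j k≡jr) x = begin
      k · x                    ≈⟨ ×-congˡ (≡.trans k≡jr (ℕ.*-comm j r)) ⟩
      (r ℕ.* j) · x            ≈⟨ ×-assocˡ x r j ⟨
      r · (j · x)              ≈⟨ ×-congʳ r (*-identityˡ (j · x)) ⟨
      r · (1# * (j · x))       ≈⟨ ×-assoc-* r 1# (j · x) ⟨
      (r · 1#) * (j · x)       ≈⟨ *-congʳ r·1≈0 ⟩
      0# * (j · x)             ≈⟨ zeroˡ (j · x) ⟩
      0#                       ∎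

    ^r-homo-+ : ∀ x y → (x + y) ^ r ≈ x ^ r + y ^ r
    ^r-homo-+ x y = go r ≡.refl
      where
      go : ∀ r′ → r′ ≡ r → (x + y) ^ r′ ≈ x ^ r′ + y ^ r′
      go zero eq = contradiction (≡.sym eq) (ℕ.≢-nonZero⁻¹ r {{prime⇒nonZero r-prime}})
      go (suc r-1) ≡.refl = begin
        (x + y) ^ r                                    ≈⟨ Binomial.theorem commutativeSemiring r x y ⟩
        t zero + sum (tail t)                          ≈⟨ +-congˡ (sum-init-last (tail t)) ⟩
        t zero + (sum (init (tail t)) + last (tail t)) ≈⟨ +-cong t-first (+-cong middle t-last) ⟩
        y ^ r + (0# + x ^ r)                           ≈⟨ +-congˡ (+-identityˡ (x ^ r)) ⟩
        y ^ r + x ^ r                                  ≈⟨ +-comm (y ^ r) (x ^ r) ⟩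
        x ^ r + y ^ r                                  ∎
        where
        t = Binomial.binomialTerm commutativeSemiring x y r
        t-first : t zero ≈ y ^ r
        t-first = trans (1· _) (*-identityˡ (y ^ r))
        t-last : last (tail t) ≈ x ^ r
        t-last = begin
          (r C toℕ (fromℕ r)) · (x ^ toℕ (fromℕ r) * y ^ (r ∸ toℕ (fromℕ r)))
            ≡⟨ ≡.cong (λ j → (r C j) · (x ^ j * y ^ (r ∸ j))) (Fin.toℕ-fromℕ r) ⟩
          (r C r) · (x ^ r * y ^ (r ∸ r))
            ≡⟨ ≡.cong₂ (λ a b → a · (x ^ r * y ^ b)) (nCn≡1 r) (ℕ.n∸n≡0 r) ⟩
          1 · (x ^ r * 1#)
            ≈⟨ trans (1· _) (*-identityʳ (x ^ r)) ⟩
          x ^ r ∎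
        middle : sum (init (tail t)) ≈ 0#
        middle = trans (sum-cong-≋ λ i → r∣k⇒k·x≈0 (prime∣C r-prime (s≤s z≤n)
            (s≤s (≡.subst (_< r-1) (≡.sym (Fin.toℕ-inject₁ i)) (Fin.toℕ<n i)))) _)
          (sum-replicate-zero r-1)

    frob : Carrier → Carrier
    frob x = x ^ q

    frob-cong : ∀ {x y} → x ≈ y → frob x ≈ frob y
    frob-cong = ^-congˡ q

    ^r^e-homo-+ : ∀ e x y → (x + y) ^ (r ℕ.^ e) ≈ x ^ (r ℕ.^ e) + y ^ (r ℕ.^ e)
    ^r^e-homo-+ zero x y = trans (*-identityʳ _) (sym (+-cong (*-identityʳ x) (*-identityʳ y)))
    ^r^e-homo-+ (suc e) x y = begin
      (x + y) ^ (r ℕ.* r ℕ.^ e)                          ≈⟨ ^-assocʳ (x + y) r (r ℕ.^ e) ⟨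
      ((x + y) ^ r) ^ (r ℕ.^ e)                          ≈⟨ ^-congˡ (r ℕ.^ e) (^r-homo-+ x y) ⟩
      (x ^ r + y ^ r) ^ (r ℕ.^ e)                        ≈⟨ ^r^e-homo-+ e (x ^ r) (y ^ r) ⟩
      (x ^ r) ^ (r ℕ.^ e) + (y ^ r) ^ (r ℕ.^ e)          ≈⟨ +-cong (^-assocʳ x r (r ℕ.^ e)) (^-assocʳ y r (r ℕ.^ e)) ⟩
      x ^ (r ℕ.* r ℕ.^ e) + y ^ (r ℕ.* r ℕ.^ e)          ∎

    frob-homo-+ : ∀ x y → frob (x + y) ≈ frob x + frob y
    frob-homo-+ x y = ≡.subst (λ q → (x + y) ^ q ≈ x ^ q + y ^ q) (≡.sym q≡r^) (^r^e-homo-+ (suc k) x y)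

    frob-homo-* : ∀ x y → frob (x * y) ≈ frob x * frob y
    frob-homo-* x y = ^-distrib-* x y q

    frob-0 : frob 0# ≈ 0#
    frob-0 = 0^ q

    frob-neg : ∀ x → frob (- x) ≈ - frob x
    frob-neg x = GroupProperties.inverseʳ-unique +-group (frob x) (frob (- x))
      (trans (sym (frob-homo-+ x (- x))) (trans (frob-cong (-‿inverseʳ x)) frob-0))

    frob-eval : ∀ {k} (a : Vector Carrier k) x → frob (eval a x) ≈ eval (frob ∘ a) (frob x)
    frob-eval a x = trans (frob-sum (λ i → a i * x ^ toℕ i)) (sum-cong-≋ λ i → begin
      frob (a i * x ^ toℕ i)                 ≈⟨ frob-homo-* (a i) (x ^ toℕ i) ⟩
      frob (a i) * (x ^ toℕ i) ^ q           ≈⟨ *-congˡ (^-assocʳ x (toℕ i) q) ⟩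
      frob (a i) * x ^ (toℕ i ℕ.* q)         ≈⟨ *-congˡ (^-congʳ x (ℕ.*-comm (toℕ i) q)) ⟩
      frob (a i) * x ^ (q ℕ.* toℕ i)         ≈⟨ *-congˡ (^-assocʳ x q (toℕ i)) ⟨
      frob (a i) * frob x ^ toℕ i            ∎)
      where
      frob-sum : ∀ {k} (t : Vector Carrier k) → frob (sum t) ≈ sum (frob ∘ t)
      frob-sum {zero} t = frob-0
      frob-sum {suc k} t = trans (frob-homo-+ (head t) (sum (tail t))) (+-congˡ (frob-sum (tail t)))

    V : Pred Carrier ℓ₁
    V x = frob x ≈ x

    V-isSubfield : IsSubfield q m K V
    V-isSubfield = record
      { resp = λ x≈y Vx → trans (frob-cong (sym x≈y)) (trans Vx x≈y)
      ; 0-closed = frob-0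
      ; 1-closed = 1^ q
      ; +-closed = λ {x} {y} Vx Vy → trans (frob-homo-+ x y) (+-cong Vx Vy)
      ; *-closed = λ {x} {y} Vx Vy → trans (frob-homo-* x y) (*-cong Vx Vy)
      ; neg-closed = λ {x} Vx → trans (frob-neg x) (-‿cong Vx)
      ; inv-closed = λ {x} {y} Vx xy≈1 → *-cancelˡ-≉0
          (λ x≈0 → 1≉0 (trans (sym xy≈1) (trans (*-congʳ x≈0) (zeroˡ y)))) (begin
          x * frob y        ≈⟨ *-congʳ Vx ⟨
          frob x * frob y   ≈⟨ frob-homo-* x y ⟨
          frob (x * y)      ≈⟨ frob-cong xy≈1 ⟩
          frob 1#           ≈⟨ 1^ q ⟩
          1#                ≈⟨ xy≈1 ⟨
          x * y             ∎)
      }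

    module Count (m-prime : Prime m) where

      φ : Fin n → Fin n
      φ i = ι (frob (κ i))

      κ-fold : ∀ i j → κ (fold i φ j) ≈ κ i ^ (q ℕ.^ j)
      κ-fold i zero = sym (*-identityʳ (κ i))
      κ-fold i (suc j) = begin
        κ (ι (frob (κ (fold i φ j))))   ≈⟨ κι _ ⟩
        frob (κ (fold i φ j))           ≈⟨ frob-cong (κ-fold i j) ⟩
        (κ i ^ (q ℕ.^ j)) ^ q           ≈⟨ ^-assocʳ (κ i) (q ℕ.^ j) q ⟩
        κ i ^ (q ℕ.^ j ℕ.* q)           ≈⟨ ^-congʳ (κ i) (ℕ.*-comm (q ℕ.^ j) q) ⟩
        κ i ^ (q ℕ.* q ℕ.^ j)           ∎

      φᵐ≗id : ∀ i → fold i φ m ≡ i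
      φᵐ≗id i = κ-injective (trans (κ-fold i m) (x^n≈x (κ i)))

      open PrimeOrder φ m-prime φᵐ≗id
      O : OrbitDecomposition φ m
      O = orbitDecomposition
      open OrbitDecomposition O public

      fixed⇒V : ∀ {i} → φ i ≡ i → V (κ i)
      fixed⇒V eq = trans (sym (κι _)) (reflexive (≡.cong κ eq))

      V⇒fixed : ∀ {i} → V (κ i) → φ i ≡ i
      V⇒fixed {i} Vi = ≡.trans (ι-cong Vi) (ικ i)

      -- X^q − X has at most q roots, and the complementary factor of X^(q^m) − X at most q^m − q.
      #fixed≡q : #fixed ≡ q
      #fixed≡q = go q m ≡.refl ≡.refl
        where
        go : ∀ q′ m′ → q′ ≡ q → m′ ≡ m → #fixed ≡ q
        go zero _ eq _ = contradiction (≡.sym eq) (ℕ.≢-nonZero⁻¹ q)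
        go 1 _ eq _ = contradiction (primePower>1 q-pp) (ℕ.≤⇒≯ (ℕ.≤-reflexive (≡.sym eq)))
        go _ zero _ eq = contradiction (≡.sym eq) (ℕ.≢-nonZero⁻¹ m {{prime⇒nonZero m-prime}})
        go (suc (suc e)) (suc m-1) ≡.refl ≡.refl = ℕ.≤-antisym #fixed≤q
            (ℕ.+-cancelˡ-≤ (N ℕ.* suc e) _ _ (ℕ.≤-trans (ℕ.≤-reflexive (≡.trans N-eq (≡.sym (#fixed+#free*p≡n O))))
              (ℕ.≤-trans (ℕ.≤-reflexive (ℕ.+-comm #fixed (#free ℕ.* m))) (ℕ.+-monoˡ-≤ #fixed #moved≤))))
          where
          N = proj₁ ([1+e]^[1+p]≡1+e+Ne (suc e) m-1)
          N-eq = proj₂ ([1+e]^[1+p]≡1+e+Ne (suc e) m-1)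
          #fixed≤q : #fixed ≤ q
          #fixed≤q = ≡.subst (λ d → #fixed ≤ 2 ℕ.+ d) (ℕ.+-identityʳ e)
            (#roots≤degree (monic-horner 0# (monic-horner (- 1#) (monic-^* e monic-1)))
            (κ ∘ fix) (fix-injective ∘ κ-injective) (λ i → root (fixed⇒V (fix-fixed i))))
            where
            root : ∀ {x} → V x → 0# + x * (- 1# + x * (x ^ e * 1#)) ≈ 0#
            root {x} Vx = begin
              0# + x * (- 1# + x * (x ^ e * 1#))   ≈⟨ solve 3 (λ x n y → con 0 :+ x :* (n :+ x :* (y :* con 1)) := x :* n :+ x :* (x :* y)) refl x (- 1#) (x ^ e) ⟩
              x * - 1# + frob x                    ≈⟨ +-congˡ (trans Vx (sym (*-identityʳ x))) ⟩
              x * - 1# + x * 1#                    ≈⟨ distribˡ x (- 1#) 1# ⟨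
              x * (- 1# + 1#)                      ≈⟨ trans (*-congˡ (-‿inverseˡ 1#)) (zeroʳ x) ⟩
              0#                                   ∎
          #moved≤ : #free ℕ.* m ≤ N ℕ.* suc e
          #moved≤ = #roots≤degree (geometric-monic e N) (κ ∘ mov O ∘ remQuot m)
            (λ {s} {t} eq → remQuot-injective m {s} {t} (mov-injective O (κ-injective eq)))
            (λ s → root (λ Vx → mov-moved O (remQuot m s) (V⇒fixed Vx)))
            where
            root : ∀ {x} → ¬ V x → geometric (suc e) N x ≈ 0#
            root {x} ¬Vx = cancel (¬Vx ∘ x-y≈0⇒x≈y) (begin
              (frob x - x) * geometric (suc e) N x    ≈⟨ geometric-sum (suc e) N x ⟩
              x ^ (N ℕ.* suc e ℕ.+ q) - x             ≈⟨ +-congʳ (trans (^-congʳ x N-eq) (x^n≈x x)) ⟩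
              x - x                                   ≈⟨ -‿inverseʳ x ⟩
              0#                                      ∎)

      V-size : HasSize (subset q m K V) q
      V-size = ≡.subst (HasSize (subset q m K V)) #fixed≡q (record
        { to = to
        ; from = λ i → κ (fix i) , fixed⇒V (fix-fixed i)
        ; to-cong = λ {x} {y} → to-cong {x} {y}
        ; from-cong = λ { ≡.refl → refl }
        ; inverse = (λ {i} {x} eq → fix-injective (≡.trans (fix-to x) (≡.trans (ι-cong eq) (ικ (fix i)))))
                  , (λ { {x} ≡.refl → trans (reflexive (≡.cong κ (fix-to x))) (κι (proj₁ x)) })
        })
        where
        at : ∀ x → V x → ∃ λ i → fix i ≡ ι x
        at x Vx = fix-index (ι x) (V⇒fixed (resp V-isSubfield (sym (κι x)) Vx))
        to : Σ Carrier V → Fin #fixed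
        to (x , Vx) = proj₁ (at x Vx)
        fix-to : ∀ x → fix (to x) ≡ ι (proj₁ x)
        fix-to (x , Vx) = proj₂ (at x Vx)
        to-cong : ∀ {x y} → proj₁ x ≈ proj₁ y → to x ≡ to y
        to-cong {x} {y} eq = fix-injective (≡.trans (fix-to x) (≡.trans (ι-cong eq) (≡.sym (fix-to y))))

      𝔽q⇒V : ∀ {x} → 𝔽 q m K q x → V x
      𝔽q⇒V (S , sub , size , Sx) = x^size≈x sub size Sx

      V⇒𝔽q : ∀ {x} → V x → 𝔽 q m K q x
      V⇒𝔽q Vx = V , V-isSubfield , V-size , Vx

      x∈𝔽n : ∀ x → 𝔽 q m K n x
      x∈𝔽n x = whole , whole-isSubfield , whole-size , _

      𝔽q¹ : ∀ {x} → 𝔽 q m K (q ℕ.^ 1) x → 𝔽 q m K q x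
      𝔽q¹ {x} = ≡.subst (λ k → 𝔽 q m K k x) (ℕ.*-identityʳ q)

      preserves⇒ : ∀ f → SubfieldPreserving q m K f → ∀ x → ¬ V x → ¬ V (f ⟨$⟩ x)
      preserves⇒ f (_ , pres) x ¬Vx Vfx = proj₂ (pres m 1 (ℕ.>-nonZero⁻¹ m {{prime⇒nonZero m-prime}}) (s≤s z≤n) (divides 1 (≡.sym (ℕ.*-identityˡ m))) (divides m (≡.sym (ℕ.*-identityʳ m)))
          x (x∈𝔽n x , ¬Vx ∘ 𝔽q⇒V ∘ 𝔽q¹))
        (≡.subst (λ k → 𝔽 q m K k (f ⟨$⟩ x)) (≡.sym (ℕ.*-identityʳ q)) (V⇒𝔽q Vfx))

      preserves⇐ : ∀ f → (∀ x → V x → V (f ⟨$⟩ x)) → (∀ x → ¬ V x → ¬ V (f ⟨$⟩ x)) → SubfieldPreserving q m K f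
      preserves⇐ f V→V ¬V→¬V = (λ x → V⇒𝔽q ∘ V→V x ∘ 𝔽q⇒V) , pres
        where
        pres : ∀ d s → 0 < d → 0 < s → d ∣ m → s ∣ m → ∀ x →
               𝔽 q m K (q ℕ.^ d) x × ¬ 𝔽 q m K (q ℕ.^ s) x →
               𝔽 q m K (q ℕ.^ d) (f ⟨$⟩ x) × ¬ 𝔽 q m K (q ℕ.^ s) (f ⟨$⟩ x)
        pres d s _ _ d∣m s∣m x (x∈ , x∉) with prime⇒irreducible m-prime d∣m | prime⇒irreducible m-prime s∣m
        ... | _ | inj₂ ≡.refl = contradiction (x∈𝔽n x) x∉
        ... | inj₁ ≡.refl | inj₁ ≡.refl = contradiction x∈ x∉
        ... | inj₂ ≡.refl | inj₁ ≡.refl = x∈𝔽n _ , λ fx∈ → ¬V→¬V x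
              (λ Vx → x∉ (≡.subst (λ k → 𝔽 q m K k x) (≡.sym (ℕ.*-identityʳ q)) (V⇒𝔽q Vx))) (𝔽q⇒V (𝔽q¹ fx∈))

      -- If f commutes with Frobenius, the polynomial Σ (aᵢ^q − aᵢ) Xⁱ vanishes at every x^q, hence everywhere.
      commutes⇒coefficients : ∀ (f : Carrier → Carrier) (a : Vector Carrier n) → (∀ x → f x ≈ eval a x) →
                              (∀ x → f (frob x) ≈ frob (f x)) → ∀ i → V (a i)
      commutes⇒coefficients f a f≈ comm i = x-y≈0⇒x≈y (roots⇒≈0 (λ i → frob (a i) - a i) (κ ∘ φ) (φ-injective ∘ κ-injective)
        (λ j → begin
          eval (λ i → frob (a i) - a i) (κ (φ j))                ≈⟨ eval-cong (λ i → frob (a i) - a i) (κι (frob (κ j))) ⟩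
          eval (λ i → frob (a i) - a i) (frob (κ j))             ≈⟨ eval-- (frob ∘ a) a (frob (κ j)) ⟩
          eval (frob ∘ a) (frob (κ j)) - eval a (frob (κ j))     ≈⟨ +-cong (frob-eval a (κ j)) (-‿cong (f≈ (frob (κ j)))) ⟨
          frob (eval a (κ j)) - f (frob (κ j))                   ≈⟨ +-cong (frob-cong (sym (f≈ (κ j)))) (-‿cong (comm (κ j))) ⟩
          frob (f (κ j)) - frob (f (κ j))                        ≈⟨ -‿inverseʳ _ ⟩
          0#                                                     ∎) i)

      coefficients⇒commutes : ∀ (f : Carrier → Carrier) (a : Vector Carrier n) → (∀ x → f x ≈ eval a x) →
                              (∀ i → V (a i)) → ∀ x → f (frob x) ≈ frob (f x)
      coefficients⇒commutes f a f≈ Va x = begin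
        f (frob x)                  ≈⟨ f≈ (frob x) ⟩
        eval a (frob x)             ≈⟨ sum-cong-≋ (λ i → *-congʳ (Va i)) ⟨
        eval (frob ∘ a) (frob x)    ≈⟨ frob-eval a x ⟨
        frob (eval a x)             ≈⟨ frob-cong (f≈ x) ⟨
        frob (f x)                  ∎

      T↔Admissible : Inverse (T q m K) (AdmissibleMaps φ)
      T↔Admissible = record
        { to = to
        ; from = from
        ; to-cong = λ f≈g i → ι-cong (f≈g (κ i))
        ; from-cong = λ g≗h x → reflexive (≡.cong κ (g≗h (ι x)))
        ; inverse = (λ {g} {f} f≈g i → ≡.trans (ι-cong (f≈g (κ i))) (≡.trans (ικ _) (≡.cong (proj₁ g) (ικ i))))
                  , (λ {f} {g} g≗f x → trans (reflexive (≡.cong κ (g≗f (ι x)))) (trans (κι _) (Func.cong (proj₁ f) (κι x))))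
        }
        where
        to : Σ (Func K-setoid K-setoid) (InT q m K) → Σ (Fin n → Fin n) (Admissible φ)
        to (f , pres , a , f≈ , Fa) = (λ i → ι (f ⟨$⟩ κ i)) , record
          { commutes = λ i → ι-cong (begin
              f ⟨$⟩ κ (φ i)               ≈⟨ Func.cong f (κι (frob (κ i))) ⟩
              f ⟨$⟩ frob (κ i)            ≈⟨ coefficients⇒commutes (f ⟨$⟩_) a f≈ (𝔽q⇒V ∘ Fa) (κ i) ⟩
              frob (f ⟨$⟩ κ i)            ≈⟨ frob-cong (κι _) ⟨
              frob (κ (ι (f ⟨$⟩ κ i)))    ∎)
          ; moves = λ i moved fixed → preserves⇒ f pres (κ i) (moved ∘ V⇒fixed)
              (resp V-isSubfield (κι _) (fixed⇒V fixed))
          }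
        from : Σ (Fin n → Fin n) (Admissible φ) → Σ (Func K-setoid K-setoid) (InT q m K)
        from (g , adm) = f , preserves⇐ f V→V ¬V→¬V , a , f≈ , V⇒𝔽q ∘ commutes⇒coefficients (f ⟨$⟩_) a f≈ comm
          where
          f : Func K-setoid K-setoid
          f = record { to = λ x → κ (g (ι x)) ; cong = λ x≈y → reflexive (≡.cong (κ ∘ g) (ι-cong x≈y)) }
          a = proj₁ (interpolation f)
          f≈ = proj₂ (interpolation f)
          comm : ∀ x → f ⟨$⟩ frob x ≈ frob (f ⟨$⟩ x)
          comm x = begin
            κ (g (ι (frob x)))    ≈⟨ reflexive (≡.cong (κ ∘ g) (ι-cong (frob-cong (sym (κι x))))) ⟩
            κ (g (φ (ι x)))       ≈⟨ reflexive (≡.cong κ (Admissible.commutes adm (ι x))) ⟩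
            κ (φ (g (ι x)))       ≈⟨ κι _ ⟩
            frob (κ (g (ι x)))    ∎
          V→V : ∀ x → V x → V (f ⟨$⟩ x)
          V→V x Vx = trans (sym (comm x)) (Func.cong f Vx)
          ¬V→¬V : ∀ x → ¬ V x → ¬ V (f ⟨$⟩ x)
          ¬V→¬V x ¬Vx Vfx = Admissible.moves adm (ι x)
            (λ fixed → ¬Vx (resp V-isSubfield (κι x) (fixed⇒V fixed))) (V⇒fixed Vfx)

      #T : ∃ λ k → q ℕ.+ k ℕ.* m ≡ q ℕ.^ m × HasSize (T q m K) (q ℕ.^ q ℕ.* (k ℕ.* m) ℕ.^ k)
      #T = #free , ≡.subst (λ j → j ℕ.+ #free ℕ.* m ≡ n) #fixed≡q (#fixed+#free*p≡n O) ,
        ≡.subst (λ j → HasSize (T q m K) (j ℕ.^ j ℕ.* (#free ℕ.* m) ℕ.^ #free)) #fixed≡q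
          (Compose.inverse T↔Admissible (#admissible O))

open import Data.Nat.Base using (ℕ; _≤_; _^_)
open import Data.Nat.Primality using (Prime)
open import Data.Product.Base using (∃; _×_)
open import Data.Rational.Base using (ℚ; 0ℚ; 1ℚ; _-_; ∣_∣) renaming (_<_ to _<ℚ_)

corollary21 : ∀ {c ℓ₁ ℓ₂} →
    (∀ (q : ℕ) (q-pp : IsPrimePower q) (ε : ℚ) → 0ℚ <ℚ ε →
    ∃ λ (N : ℕ) → ∀ (p : ℕ) → Prime p → N ≤ p →
    ∀ (K : FiniteField c ℓ₁ ℓ₂ (q ^ p)) →
    ∃ λ (t : ℕ) → HasSize (T q p K) t × ∣ ratio q-pp p t - 1ℚ ∣ <ℚ ε)
    ×
    (∀ (p : ℕ) → Prime p → ∀ (ε : ℚ) → 0ℚ <ℚ ε →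
    ∃ λ (N : ℕ) → ∀ (q : ℕ) (q-pp : IsPrimePower q) → N ≤ q →
    ∀ (K : FiniteField c ℓ₁ ℓ₂ (q ^ p)) →
    ∃ λ (t : ℕ) → HasSize (T q p K) t × ∣ ratio q-pp p t - 0ℚ ∣ <ℚ ε)
corollary21 =
  (λ q q-pp ε ε>0 → let instance q≢0 = primePower⇒nonZero q-pp in
    suc (q ℕ.* ℚ.↧ₙ ε) , λ p p-prime N≤p K →
      let k , q+kp≡q^p , size = Field.Frobenius.Count.#T q p K q-pp p-prime
      in _ , size , near-1 (q ^ q ℕ.* (k ℕ.* p) ^ k) (q ^ (q ^ p)) {{ℕ.m^n≢0 q (q ^ p)}} ε ε>0
           (count≤ q p k q+kp≡q^p (ℚ.↧ₙ ε)) (count-lower q p k q+kp≡q^p (ℚ.↧ₙ ε) N≤p)) ,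
  (λ p p-prime ε ε>0 →
    2 ℕ.* p ℕ.* ℚ.↧ₙ ε , λ q q-pp N≤q K →
      let instance q≢0 = primePower⇒nonZero q-pp
          k , q+kp≡q^p , size = Field.Frobenius.Count.#T q p K q-pp p-prime
      in _ , size , near-0 (q ^ q ℕ.* (k ℕ.* p) ^ k) (q ^ (q ^ p)) {{ℕ.m^n≢0 q (q ^ p)}} ε ε>0
           (count-upper q p k q+kp≡q^p (ℚ.↧ₙ ε) (primePower>1 q-pp) (prime>1 p-prime) N≤q))
  where open Estimates
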